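{- Let $>$ be a reduction order and let $\Gamma\colon(\mathcal{E}_0,\mathcal{R}_0)\vdash_{\mathsf i}(\mathcal{E}_1,\mathcal{R}_1)\vdash_{\mathsf i}(\mathcal{E}_2,\mathcal{R}_2)\vdash_{\mathsf i}\cdots$ be an infinite run (with $\mathcal{R}_0=\varnothing$) of $\mathsf{KB_i}$ with respect to $>$. If $\Gamma$ is fair then $\mathcal{R}_\omega$ is a complete presentation of $\mathcal{E}_0$.
   Context: Terms are built from a signature $\mathcal{F}$ and an infinite set of variables $\mathcal{V}$. An equational system (ES) is a set of pairs of terms $s\approx t$; a TRS is a set of pairs $\ell\to r$ with $\ell$ not a variable and every variable of $r$ occurring in $\ell$. For a set $X$ of pairs of terms, $\to_X$ is its closure under contexts and substitutions, $\leftrightarrow_X$ the symmetric closure of $\to_X$, $\leftrightarrow_X^*$ the conversion relation, and $\downarrow_X\,=\,\to_X^*\cdot{}_X^*{\leftarrow}$ joinability. A TRS is complete if it is terminating and confluent; $\mathcal{R}$ is a complete presentation of $\mathcal{E}$ if $\mathcal{R}$ is complete and $\leftrightarrow_{\mathcal{R}}^*\,=\,\leftrightarrow_{\mathcal{E}}^*$. A reduction order is a well-founded strict order on terms closed under contexts and substitutions. A term $s$ encompasses $t$ if $s=C[t\sigma]$ for some context $C$ and substitution $\sigma$; $s$ properly encompasses $t$ if $s$ encompasses $t$ but $t$ does not encompass $s$. Prime critical pairs: an overlap of $\mathcal{R}$ is a triple $\langle \ell_1\to r_1,p,\ell_2\to r_2\rangle$ where the two rules are variants (up to bijective variable renaming)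 of rules of $\mathcal{R}$ without common variables, $p$ is a non-variable position of $\ell_2$, $\ell_1$ and $\ell_2|_p$ are unifiable, and if $p=\epsilon$ the two rules are not variants of each other. With $\sigma$ a most general unifier of $\ell_1$ and $\ell_2|_p$, the critical pair is $\ell_2\sigma[r_1\sigma]_p\approx r_2\sigma$. It is prime if all proper subterms of $\ell_2\sigma|_p$ are normal forms with respect to $\mathcal{R}$. $\mathrm{PCP}(\mathcal{R})$ is the set of prime critical pairs of $\mathcal{R}$. Inference system $\mathsf{KB_i}$ ($\uplus$ is disjoint union): $(\mathcal{E},\mathcal{R})\vdash_{\mathsf i}(\mathcal{E}',\mathcal{R}')$ if it is an instance of one of - deduce: $(\mathcal{E},\mathcal{R})\vdash(\mathcal{E}\cup\{s\approx t\},\mathcal{R})$ if $s\,{}_{\mathcal{R}}{\leftarrow}\cdot\to_{\mathcal{R}}t$; - orient: $(\mathcal{E}\uplus\{s\approx t\},\mathcal{R})\vdash(\mathcal{E},\mathcal{R}\cup\{s\to t\})$ if $s>t$, and $(\mathcal{E}\uplus\{s\approx t\},\mathcal{R})\vdash(\mathcal{E},\mathcal{R}\cup\{t\to s\})$ if $t>s$; - delete: $(\mathcal{E}\uplus\{s\approx s\},\mathcal{R})\vdash(\mathcal{E},\mathcal{R})$; - compose: $(\mathcal{E},\mathcal{R}\uplus\{s\to t\})\vdash(\mathcal{E},\mathcal{R}\cup\{s\to u\})$ if $t\to_{\mathcal{R}}u$; - simplify: $(\mathcal{E}\uplus\{s\approx t\},\mathcal{R})\vdash(\mathcal{E}\cup\{u\approx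 t\},\mathcal{R})$ if $s\to_{\mathcal{R}}u$, and $(\mathcal{E}\uplus\{s\approx t\},\mathcal{R})\vdash(\mathcal{E}\cup\{s\approx u\},\mathcal{R})$ if $t\to_{\mathcal{R}}u$; - collapse: $(\mathcal{E},\mathcal{R}\uplus\{t\to s\})\vdash(\mathcal{E}\cup\{u\approx s\},\mathcal{R})$ if $t\to u$ by a rewrite step using some rule $\ell\to r\in\mathcal{R}$ such that $t$ properly encompasses $\ell$. For an infinite run put $\mathcal{E}_\infty=\bigcup_{i\ge0}\mathcal{E}_i$, $\mathcal{R}_\infty=\bigcup_{i\ge0}\mathcal{R}_i$, $\mathcal{E}_\omega=\bigcup_{i\ge0}\bigcap_{j\ge i}\mathcal{E}_j$, $\mathcal{R}_\omega=\bigcup_{i\ge0}\bigcap_{j\ge i}\mathcal{R}_j$. The run is fair if $\mathcal{E}_\omega=\varnothing$ and $\mathrm{PCP}(\mathcal{R}_\omega)\subseteq{\downarrow_{\mathcal{R}_\omega}}\cup{\leftrightarrow_{\mathcal{E}_\infty}}$. -}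

module Defs where

open import Data.List.Base using (List)
import Data.List.Membership.Propositional as List
open import Data.Nat.Base using (ℕ; zero; suc; _≤_)
open import Data.Product.Base using (Σ-syntax; ∃; ∃₂; _×_; _,_)
open import Data.Vec.Base using (Vec; []; _∷_)
open import Function.Base using (flip; _∘_)
open import Function.Bundles using (_↔_; Inverse)
open import Induction.WellFounded using (WellFounded)
open import Level using (0ℓ)
open import Relation.Binary.Construct.Closure.Equivalence using (EqClosure)
open import Relation.Binary.Construct.Closure.ReflexiveTransitive using (Star)
open import Relation.Binary.Construct.Closure.Symmetric using (SymClosure)
open import Relation.Binary.Core using (Rel; _⇔_)
open import Relation.Binary.PropositionalEquality.Core using (_≡_; _≢_)
open import Relation.Binary.Rewriting
  using (IsNormalForm; StronglyNormalizing; Confluent)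
open import Relation.Binary.Structures using (IsStrictPartialOrder)
open import Relation.Nullary.Negation.Core using (¬_)
open import Relation.Unary
  using (Pred; _∈_; _∉_; _≐_; _∪_; ｛_｝; ⋃; ⋂; Empty)

-- No finite list exhausts A.
Infinite : Set → Set
Infinite A = (xs : List A) → ∃ λ x → x List.∉ xs

record Signature : Set₁ where
  field
    Symbol : Set
    arity  : Symbol → ℕ

module Rewriting (𝓕 : Signature) (𝓥 : Set) where

  open Signature 𝓕

  data Term : Set where
    var : 𝓥 → Term
    fun : (f : Symbol) → Vec Term (arity f) → Term

  -- Used both for equational systems and for rewrite systems.
  Pairs : Set₁
  Pairs = Pred (Term × Term) 0ℓ

  Subst : Set
  Subst = 𝓥 → Term

  infixl 9 _·_ _··_ _·ᶜ_

  mutual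
    _·_ : Term → Subst → Term
    var x    · σ = σ x
    fun f ts · σ = fun f (ts ·· σ)

    _··_ : ∀ {n} → Vec Term n → Subst → Vec Term n
    []       ·· σ = []
    (t ∷ ts) ·· σ = t · σ ∷ ts ·· σ

  _·ᶜ_ : Subst → Subst → Subst
  (σ ·ᶜ τ) x = σ x · τ

  mutual
    data Context : Set where
      □   : Context
      fun : (f : Symbol) → Contexts (arity f) → Context

    -- Argument vectors in which exactly one argument is a context.
    data Contexts : ℕ → Set where
      _◂_ : ∀ {n} → Context → Vec Term n → Contexts (suc n)
      _▸_ : ∀ {n} → Term → Contexts n → Contexts (suc n)

  infix 10 _[_] _[_]ᵛ

  mutual
    _[_] : Context → Term → Term
    □        [ t ] = t
    fun f Cs [ t ] = fun f (Cs [ t ]ᵛ)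

    _[_]ᵛ : ∀ {n} → Contexts n → Term → Vec Term n
    (C ◂ us) [ t ]ᵛ = C [ t ] ∷ us
    (u ▸ Cs) [ t ]ᵛ = u ∷ Cs [ t ]ᵛ

  mutual
    data Pos : Term → Set where
      ε   : ∀ {t} → Pos t
      arg : ∀ {f ts} → Posᵛ ts → Pos (fun f ts)

    data Posᵛ : ∀ {n} → Vec Term n → Set where
      here  : ∀ {n t} {ts : Vec Term n} → Pos t → Posᵛ (t ∷ ts)
      there : ∀ {n t} {ts : Vec Term n} → Posᵛ ts → Posᵛ (t ∷ ts)

  infixl 8 _∣_ _∣ᵛ_

  mutual
    _∣_ : (t : Term) → Pos t → Term
    t        ∣ ε     = t
    fun f ts ∣ arg p = ts ∣ᵛ p

    _∣ᵛ_ : ∀ {n} (ts : Vec Term n) → Posᵛ ts → Term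
    (t ∷ ts) ∣ᵛ here p  = t ∣ p
    (t ∷ ts) ∣ᵛ there p = ts ∣ᵛ p

  mutual
    replace : (t : Term) → Pos t → Term → Term
    replace t          ε       u = u
    replace (fun f ts) (arg p) u = fun f (replaceᵛ ts p u)

    replaceᵛ : ∀ {n} (ts : Vec Term n) → Posᵛ ts → Term → Vec Term n
    replaceᵛ (t ∷ ts) (here p)  u = replace t p u ∷ ts
    replaceᵛ (t ∷ ts) (there p) u = t ∷ replaceᵛ ts p u

  -- Every position of t is also a position of t · σ.
  infixl 9 _⟨_⟩ _⟨_⟩ᵛ

  mutual
    _⟨_⟩ : ∀ {t} → Pos t → (σ : Subst) → Pos (t · σ)
    ε     ⟨ σ ⟩ = ε
    arg p ⟨ σ ⟩ = arg (p ⟨ σ ⟩ᵛ)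

    _⟨_⟩ᵛ : ∀ {n} {ts : Vec Term n} → Posᵛ ts → (σ : Subst) → Posᵛ (ts ·· σ)
    here p  ⟨ σ ⟩ᵛ = here (p ⟨ σ ⟩)
    there p ⟨ σ ⟩ᵛ = there (p ⟨ σ ⟩ᵛ)

  _∈Var_ : 𝓥 → Term → Set
  x ∈Var t = ∃ λ (p : Pos t) → t ∣ p ≡ var x

  _ProperSubtermOf_ : Term → Term → Set
  u ProperSubtermOf t = ∃ λ (p : Pos t) → p ≢ ε × t ∣ p ≡ u

  _⊵_ : Rel Term 0ℓ
  s ⊵ t = ∃₂ λ C σ → s ≡ C [ t · σ ]

  _▷_ : Rel Term 0ℓ
  s ▷ t = s ⊵ t × ¬ (t ⊵ s)

  record ⟶⟨_⟩ (X : Pairs) (s t : Term) : Set where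
    constructor step
    field
      {ℓ r} : Term
      rule  : (ℓ , r) ∈ X
      C     : Context
      σ     : Subst
      s≡    : s ≡ C [ ℓ · σ ]
      t≡    : t ≡ C [ r · σ ]

  ⟶*⟨_⟩ ⟷⟨_⟩ ⟷*⟨_⟩ ↓⟨_⟩ : Pairs → Rel Term 0ℓ
  ⟶*⟨ X ⟩ = Star ⟶⟨ X ⟩
  ⟷⟨ X ⟩  = SymClosure ⟶⟨ X ⟩
  ⟷*⟨ X ⟩ = EqClosure ⟶⟨ X ⟩
  ↓⟨ X ⟩ s t = ∃ λ u → ⟶*⟨ X ⟩ s u × ⟶*⟨ X ⟩ t u

  record IsTRS (R : Pairs) : Set where
    field
      lhs-nonvar : ∀ {ℓ r} → (ℓ , r) ∈ R → ∀ x → ℓ ≢ var x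
      rhs-vars   : ∀ {ℓ r} → (ℓ , r) ∈ R → ∀ {x} → x ∈Var r → x ∈Var ℓ

  record IsComplete (R : Pairs) : Set where
    field
      terminating : StronglyNormalizing ⟶⟨ R ⟩
      confluent   : Confluent ⟶⟨ R ⟩

  record IsCompletePresentation (R E : Pairs) : Set where
    field
      isTRS      : IsTRS R
      isComplete : IsComplete R
      conversion : ⟷*⟨ R ⟩ ⇔ ⟷*⟨ E ⟩

  record IsReductionOrder (_>_ : Rel Term 0ℓ) : Set where
    field
      isStrictPartialOrder : IsStrictPartialOrder _≡_ _>_
      wellFounded          : WellFounded (flip _>_)
      closed-context       : ∀ {s t} C → s > t → (C [ s ]) > (C [ t ])
      closed-subst         : ∀ {s t} σ → s > t → (s · σ) > (t · σ)

  _IsVariantOf_ : Rel (Term × Term) 0ℓ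
  (ℓ , r) IsVariantOf (ℓ′ , r′) =
    Σ[ ρ ∈ 𝓥 ↔ 𝓥 ] let π = var ∘ Inverse.to ρ in
      ℓ ≡ ℓ′ · π × r ≡ r′ · π

  _OccursIn_ : 𝓥 → Pred (Term × Term) 0ℓ
  x OccursIn (ℓ , r) = x ∈ (λ y → y ∈Var ℓ) ∪ (λ y → y ∈Var r)

  IsUnifier : Subst → Rel Term 0ℓ
  IsUnifier σ s t = s · σ ≡ t · σ

  IsMGU : Subst → Rel Term 0ℓ
  IsMGU σ s t =
    IsUnifier σ s t ×
    (∀ τ → IsUnifier τ s t → ∃ λ δ → ∀ x → τ x ≡ (σ ·ᶜ δ) x)

  record Overlap (R : Pairs) : Set where
    field
      {ℓ₁ r₁ ℓ₂ r₂} : Term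
      variant₁   : ∃ λ rule → rule ∈ R × (ℓ₁ , r₁) IsVariantOf rule
      variant₂   : ∃ λ rule → rule ∈ R × (ℓ₂ , r₂) IsVariantOf rule
      disjoint   : ∀ x → x OccursIn (ℓ₁ , r₁) → ¬ (x OccursIn (ℓ₂ , r₂))
      p          : Pos ℓ₂
      p-nonvar   : ∀ x → ℓ₂ ∣ p ≢ var x
      unifiable  : ∃ λ σ → IsUnifier σ ℓ₁ (ℓ₂ ∣ p)
      root       : p ≡ ε → ¬ ((ℓ₁ , r₁) IsVariantOf (ℓ₂ , r₂))

  -- Critical pairs are collected for all choices of variants and of most
  -- general unifiers.
  record PCP (R : Pairs) (st : Term × Term) : Set where
    field
      source : Overlap R
    open Overlap source
    field
      σ     : Subst
      mgu   : IsMGU σ ℓ₁ (ℓ₂ ∣ p)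
      pair  : st ≡ (replace (ℓ₂ · σ) (p ⟨ σ ⟩) (r₁ · σ) , r₂ · σ)
      prime : ∀ u → u ProperSubtermOf (ℓ₂ · σ ∣ p ⟨ σ ⟩) →
              IsNormalForm ⟶⟨ R ⟩ u

  module Completion (_>_ : Rel Term 0ℓ) where

    State : Set₁
    State = Pairs × Pairs

    infix 3 _⊢_ _⊢ᵢ_

    -- The premises  e ∉ E  and  e ∉ R  express that the unions on the left
    -- are disjoint.
    data _⊢_ : State → State → Set₁ where

      deduce : ∀ {E R s t w} →
        ⟶⟨ R ⟩ w s → ⟶⟨ R ⟩ w t →
        (E , R) ⊢ (E ∪ ｛ s , t ｝ , R)

      orientˡ : ∀ {E R s t} → (s , t) ∉ E →
        s > t →
        (E ∪ ｛ s , t ｝ , R) ⊢ (E , R ∪ ｛ s , t ｝)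

      orientʳ : ∀ {E R s t} → (s , t) ∉ E →
        t > s →
        (E ∪ ｛ s , t ｝ , R) ⊢ (E , R ∪ ｛ t , s ｝)

      delete : ∀ {E R s} → (s , s) ∉ E →
        (E ∪ ｛ s , s ｝ , R) ⊢ (E , R)

      compose : ∀ {E R s t u} → (s , t) ∉ R →
        ⟶⟨ R ⟩ t u →
        (E , R ∪ ｛ s , t ｝) ⊢ (E , R ∪ ｛ s , u ｝)

      simplifyˡ : ∀ {E R s t u} → (s , t) ∉ E →
        ⟶⟨ R ⟩ s u →
        (E ∪ ｛ s , t ｝ , R) ⊢ (E ∪ ｛ u , t ｝ , R)

      simplifyʳ : ∀ {E R s t u} → (s , t) ∉ E →
        ⟶⟨ R ⟩ t u →
        (E ∪ ｛ s , t ｝ , R) ⊢ (E ∪ ｛ s , u ｝ , R)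

      collapse : ∀ {E R s t u ℓ r} → (t , s) ∉ R →
        (ℓ , r) ∈ R → ⟶⟨ ｛ ℓ , r ｝ ⟩ t u → t ▷ ℓ →
        (E , R ∪ ｛ t , s ｝) ⊢ (E ∪ ｛ u , s ｝ , R)

    _≐ₛ_ : State → State → Set
    (E , R) ≐ₛ (E′ , R′) = E ≐ E′ × R ≐ R′

    -- Predicates with the same elements need not be propositionally equal,
    -- so instances of the rules are taken up to extensional equality.
    _⊢ᵢ_ : State → State → Set₁
    S ⊢ᵢ S′ = ∃₂ λ T T′ → S ≐ₛ T × T ⊢ T′ × T′ ≐ₛ S′

    record IsRun (E R : ℕ → Pairs) : Set₁ where
      field
        start : Empty (R zero)
        steps : ∀ i → (E i , R i) ⊢ᵢ (E (suc i) , R (suc i))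

  _∞ _ω : (ℕ → Pairs) → Pairs
  X ∞ = ⋃[ i ∶ ℕ ] X i
  X ω = ⋃[ i ∶ ℕ ] ⋂[ (j , _) ∶ ∃ (i ≤_) ] X j

  record IsFair (E R : ℕ → Pairs) : Set where
    field
      no-persistent-equations : Empty (E ω)
      prime-critical-pairs    : ∀ {s t} → (s , t) ∈ PCP (R ω) →
        (s , t) ∈ (λ (u , v) → ↓⟨ R ω ⟩ u v) ∪ (λ (u , v) → ⟷⟨ E ∞ ⟩ u v)

{-# OPTIONS --safe #-}
module Submission where

-- All rules of R∞ decrease in >, which makes Rω a terminating TRS, and every
-- inference is sound for the conversion of E₀.  By well-founded induction on
-- the left-hand side with respect to (> · ⊵) ∪ ▷, and then on the right-hand
-- side with respect to >, any rule that is eventually composed or collapsed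
-- can be replaced by a conversion in Rω in which no term exceeds the source of
-- the step; likewise a step by an equation of E∞ is replaced by a conversion
-- each of whose terms is bounded by one of its ends.  By fairness prime
-- critical pairs are therefore connected in Rω below the source of the peak.
-- In an arbitrary peak t ← s → u, both steps are compared with a step s → v at
-- an innermost redex: each comparison involves at most a prime overlap, so t
-- and u are connected through v by terms below s, and well-founded induction
-- on s yields confluence.

open import Defs
open import Axiom.ExcludedMiddle using (ExcludedMiddle)
open import Data.Empty using (⊥-elim)
open import Data.List.Base using (List; []; _∷_; _++_; map; length)
open import Data.List.Membership.Propositional using () renaming (_∈_ to _∈ˡ_; _∉_ to _∉ˡ_)
open import Data.List.Membership.Propositional.Properties
  using (∈-++⁺ˡ; ∈-++⁺ʳ; ∈-++⁻; ∈-map⁺; ∈-map⁻)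
open import Data.List.Properties using (map-++; length-map)
open import Data.List.Relation.Unary.All using (All; []; _∷_)
open import Data.List.Relation.Unary.Any using (here; there)
open import Data.Nat.Base
  using (ℕ; zero; suc; _+_; _∸_; _≤_; _<_; z≤n; s≤s; s≤s⁻¹; _≤′_; ≤′-refl; ≤′-step)
open import Data.Nat.Induction using (<-wellFounded)
import Data.Nat.Properties as ℕ
open import Data.Product.Base using (∃; ∃₂; _×_; _,_; proj₁; proj₂)
open import Data.Product.Relation.Binary.Lex.Strict using (×-Lex; ×-wellFounded)
open import Data.Sum.Base using (_⊎_; inj₁; inj₂)
open import Data.Unit.Base using (⊤; tt)
open import Data.Vec.Base using (Vec; []; _∷_)
open import Data.Vec.Relation.Binary.Pointwise.Inductive using (Pointwise; []; _∷_)
open import Function.Base using (_∘_; flip)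
open import Function.Bundles using (_↔_; Inverse; mk↔ₛ′)
open import Function.Construct.Composition using (_↔-∘_)
open import Function.Construct.Identity using (↔-id)
open import Induction.WellFounded using (WellFounded; Acc; acc; module Subrelation)
open import Level using (0ℓ)
open import Relation.Binary.Core using (Rel)
import Relation.Binary.Construct.Closure.Equivalence as Eq
open import Relation.Binary.Construct.Closure.ReflexiveTransitive as Star using (Star; ε; _◅_; _◅◅_)
open import Relation.Binary.Construct.Closure.Symmetric as Sym using (fwd; bwd)
import Relation.Binary.Construct.On as On
open import Relation.Binary.PropositionalEquality
  using (_≡_; _≢_; refl; sym; trans; cong; cong₂; subst; subst₂)
open import Relation.Binary.Rewriting using (IsNormalForm; StronglyNormalizing; Confluent)
open import Relation.Binary.Structures using (IsStrictPartialOrder)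
open import Relation.Nullary using (yes; no; ¬_)
open import Relation.Unary using (｛_｝)

-- Terms, contexts and substitutions

module Terms (𝓕 : Signature) (𝓥 : Set) where

  open Signature 𝓕
  open Rewriting 𝓕 𝓥

  mutual
    vars : Term → List 𝓥
    vars (var x)    = x ∷ []
    vars (fun f ts) = varsᵛ ts

    varsᵛ : ∀ {n} → Vec Term n → List 𝓥
    varsᵛ []       = []
    varsᵛ (t ∷ ts) = vars t ++ varsᵛ ts

  mutual
    size : Term → ℕ
    size (var x)    = 1
    size (fun f ts) = 2 + sizeᵛ ts

    sizeᵛ : ∀ {n} → Vec Term n → ℕ
    sizeᵛ []       = 0
    sizeᵛ (t ∷ ts) = size t + sizeᵛ ts

  mutual
    ∈Var⇒∈vars : ∀ t {x} → x ∈Var t → x ∈ˡ vars t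
    ∈Var⇒∈vars (var x)    (ε , refl)  = here refl
    ∈Var⇒∈vars (fun f ts) (arg p , e) = ∈Varᵛ⇒∈varsᵛ ts p e

    ∈Varᵛ⇒∈varsᵛ : ∀ {n} (ts : Vec Term n) {x} (p : Posᵛ ts) → ts ∣ᵛ p ≡ var x → x ∈ˡ varsᵛ ts
    ∈Varᵛ⇒∈varsᵛ (t ∷ ts) (here p)  e = ∈-++⁺ˡ (∈Var⇒∈vars t (p , e))
    ∈Varᵛ⇒∈varsᵛ (t ∷ ts) (there p) e = ∈-++⁺ʳ (vars t) (∈Varᵛ⇒∈varsᵛ ts p e)

  mutual
    ∈vars⇒∈Var : ∀ t {x} → x ∈ˡ vars t → x ∈Var t
    ∈vars⇒∈Var (var x)    (here refl) = ε , refl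
    ∈vars⇒∈Var (fun f ts) x∈          = let p , e = ∈varsᵛ⇒∈Varᵛ ts x∈ in arg p , e

    ∈varsᵛ⇒∈Varᵛ : ∀ {n} (ts : Vec Term n) {x} → x ∈ˡ varsᵛ ts → ∃ λ (p : Posᵛ ts) → ts ∣ᵛ p ≡ var x
    ∈varsᵛ⇒∈Varᵛ (t ∷ ts) x∈ with ∈-++⁻ (vars t) x∈
    ... | inj₁ x∈t  = let p , e = ∈vars⇒∈Var t x∈t in here p , e
    ... | inj₂ x∈ts = let p , e = ∈varsᵛ⇒∈Varᵛ ts x∈ts in there p , e

  mutual
    ·-cong : ∀ t {σ τ} → (∀ x → x ∈Var t → σ x ≡ τ x) → t · σ ≡ t · τ
    ·-cong (var x)    h = h x (ε , refl)
    ·-cong (fun f ts) h = cong (fun f) (··-cong ts (λ x (p , e) → h x (arg p , e)))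

    ··-cong : ∀ {n} (ts : Vec Term n) {σ τ} →
      (∀ x → (∃ λ (p : Posᵛ ts) → ts ∣ᵛ p ≡ var x) → σ x ≡ τ x) → ts ·· σ ≡ ts ·· τ
    ··-cong []       h = refl
    ··-cong (t ∷ ts) h = cong₂ _∷_
      (·-cong t (λ x (p , e) → h x (here p , e)))
      (··-cong ts (λ x (p , e) → h x (there p , e)))

  fun-symbol : ∀ {f g} {ts : Vec Term (arity f)} {us : Vec Term (arity g)} →
    _≡_ {A = Term} (fun f ts) (fun g us) → f ≡ g
  fun-symbol refl = refl

  fun-injective : ∀ {f} {ts us : Vec Term (arity f)} → _≡_ {A = Term} (fun f ts) (fun f us) → ts ≡ us
  fun-injective refl = refl

  ∷-injective : ∀ {n t u} {ts us : Vec Term n} → t ∷ ts ≡ u ∷ us → t ≡ u × ts ≡ us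
  ∷-injective refl = refl , refl

  mutual
    ·-agree : ∀ t {σ τ} → t · σ ≡ t · τ → ∀ x → x ∈Var t → σ x ≡ τ x
    ·-agree (var x)    e y (ε , refl)   = e
    ·-agree (fun f ts) e y (arg p , e′) = ··-agree ts (fun-injective e) y p e′

    ··-agree : ∀ {n} (ts : Vec Term n) {σ τ} → ts ·· σ ≡ ts ·· τ →
      ∀ x (p : Posᵛ ts) → ts ∣ᵛ p ≡ var x → σ x ≡ τ x
    ··-agree (t ∷ ts) e x (here p)  e′ = ·-agree t (proj₁ (∷-injective e)) x (p , e′)
    ··-agree (t ∷ ts) e x (there p) e′ = ··-agree ts (proj₂ (∷-injective e)) x p e′

  mutual
    ·-id : ∀ t → t · var ≡ t
    ·-id (var x)    = refl
    ·-id (fun f ts) = cong (fun f) (··-id ts)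

    ··-id : ∀ {n} (ts : Vec Term n) → ts ·· var ≡ ts
    ··-id []       = refl
    ··-id (t ∷ ts) = cong₂ _∷_ (·-id t) (··-id ts)

  mutual
    ·-assoc : ∀ t σ τ → t · σ · τ ≡ t · (σ ·ᶜ τ)
    ·-assoc (var x)    σ τ = refl
    ·-assoc (fun f ts) σ τ = cong (fun f) (··-assoc ts σ τ)

    ··-assoc : ∀ {n} (ts : Vec Term n) σ τ → ts ·· σ ·· τ ≡ ts ·· (σ ·ᶜ τ)
    ··-assoc []       σ τ = refl
    ··-assoc (t ∷ ts) σ τ = cong₂ _∷_ (·-assoc t σ τ) (··-assoc ts σ τ)

  ·-factor : ∀ t {σ δ τ} → (∀ x → σ x · δ ≡ τ x) → t · σ · δ ≡ t · τ
  ·-factor t {σ} {δ} h = trans (·-assoc t σ δ) (·-cong t (λ x _ → h x))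

  infixr 9 _∘ᶜ_ _∘ᶜᵛ_

  mutual
    _∘ᶜ_ : Context → Context → Context
    □        ∘ᶜ D = D
    fun f Cs ∘ᶜ D = fun f (Cs ∘ᶜᵛ D)

    _∘ᶜᵛ_ : ∀ {n} → Contexts n → Context → Contexts n
    (C ◂ ts) ∘ᶜᵛ D = (C ∘ᶜ D) ◂ ts
    (t ▸ Cs) ∘ᶜᵛ D = t ▸ (Cs ∘ᶜᵛ D)

  mutual
    ∘ᶜ-[] : ∀ C D t → (C ∘ᶜ D) [ t ] ≡ C [ D [ t ] ]
    ∘ᶜ-[] □        D t = refl
    ∘ᶜ-[] (fun f Cs) D t = cong (fun f) (∘ᶜᵛ-[] Cs D t)

    ∘ᶜᵛ-[] : ∀ {n} (Cs : Contexts n) D t → (Cs ∘ᶜᵛ D) [ t ]ᵛ ≡ Cs [ D [ t ] ]ᵛ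
    ∘ᶜᵛ-[] (C ◂ ts) D t = cong (_∷ ts) (∘ᶜ-[] C D t)
    ∘ᶜᵛ-[] (u ▸ Cs) D t = cong (u ∷_) (∘ᶜᵛ-[] Cs D t)

  infixl 9 _·ᶜᵗˣ_ _·ᶜᵗˣᵛ_

  mutual
    _·ᶜᵗˣ_ : Context → Subst → Context
    □        ·ᶜᵗˣ σ = □
    fun f Cs ·ᶜᵗˣ σ = fun f (Cs ·ᶜᵗˣᵛ σ)

    _·ᶜᵗˣᵛ_ : ∀ {n} → Contexts n → Subst → Contexts n
    (C ◂ ts) ·ᶜᵗˣᵛ σ = (C ·ᶜᵗˣ σ) ◂ (ts ·· σ)
    (t ▸ Cs) ·ᶜᵗˣᵛ σ = (t · σ) ▸ (Cs ·ᶜᵗˣᵛ σ)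

  mutual
    []-· : ∀ C t σ → C [ t ] · σ ≡ (C ·ᶜᵗˣ σ) [ t · σ ]
    []-· □          t σ = refl
    []-· (fun f Cs) t σ = cong (fun f) ([]ᵛ-·· Cs t σ)

    []ᵛ-·· : ∀ {n} (Cs : Contexts n) t σ → Cs [ t ]ᵛ ·· σ ≡ (Cs ·ᶜᵗˣᵛ σ) [ t · σ ]ᵛ
    []ᵛ-·· (C ◂ ts) t σ = cong (_∷ ts ·· σ) ([]-· C t σ)
    []ᵛ-·· (u ▸ Cs) t σ = cong (u · σ ∷_) ([]ᵛ-·· Cs t σ)

  mutual
    context : ∀ t (p : Pos t) → ∃ λ C → ∀ u → C [ u ] ≡ replace t p u
    context t          ε       = □ , λ _ → refl
    context (fun f ts) (arg p) = let Cs , h = contextᵛ ts p in fun f Cs , λ u → cong (fun f) (h u)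

    contextᵛ : ∀ {n} (ts : Vec Term n) (p : Posᵛ ts) → ∃ λ Cs → ∀ u → Cs [ u ]ᵛ ≡ replaceᵛ ts p u
    contextᵛ (t ∷ ts) (here p)  = let C , h = context t p in C ◂ ts , λ u → cong (_∷ ts) (h u)
    contextᵛ (t ∷ ts) (there p) = let Cs , h = contextᵛ ts p in t ▸ Cs , λ u → cong (t ∷_) (h u)

  mutual
    replace-∣ : ∀ t (p : Pos t) → replace t p (t ∣ p) ≡ t
    replace-∣ t          ε       = refl
    replace-∣ (fun f ts) (arg p) = cong (fun f) (replaceᵛ-∣ ts p)

    replaceᵛ-∣ : ∀ {n} (ts : Vec Term n) (p : Posᵛ ts) → replaceᵛ ts p (ts ∣ᵛ p) ≡ ts
    replaceᵛ-∣ (t ∷ ts) (here p)  = cong (_∷ ts) (replace-∣ t p)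
    replaceᵛ-∣ (t ∷ ts) (there p) = cong (t ∷_) (replaceᵛ-∣ ts p)

  ∣⇒[] : ∀ t (p : Pos t) → ∃ λ C → C [ t ∣ p ] ≡ t
  ∣⇒[] t p = let C , h = context t p in C , trans (h _) (replace-∣ t p)

  mutual
    ∣-· : ∀ t (p : Pos t) σ → t · σ ∣ p ⟨ σ ⟩ ≡ (t ∣ p) · σ
    ∣-· t          ε       σ = refl
    ∣-· (fun f ts) (arg p) σ = ∣ᵛ-·· ts p σ

    ∣ᵛ-·· : ∀ {n} (ts : Vec Term n) (p : Posᵛ ts) σ → ts ·· σ ∣ᵛ p ⟨ σ ⟩ᵛ ≡ (ts ∣ᵛ p) · σ
    ∣ᵛ-·· (t ∷ ts) (here p)  σ = ∣-· t p σ
    ∣ᵛ-·· (t ∷ ts) (there p) σ = ∣ᵛ-·· ts p σ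

  mutual
    replace-· : ∀ t (p : Pos t) {σ δ τ} u → (∀ x → σ x · δ ≡ τ x) →
      replace (t · σ) (p ⟨ σ ⟩) u · δ ≡ replace (t · τ) (p ⟨ τ ⟩) (u · δ)
    replace-· t          ε       u h = refl
    replace-· (fun f ts) (arg p) u h = cong (fun f) (replaceᵛ-·· ts p u h)

    replaceᵛ-·· : ∀ {n} (ts : Vec Term n) (p : Posᵛ ts) {σ δ τ} u → (∀ x → σ x · δ ≡ τ x) →
      replaceᵛ (ts ·· σ) (p ⟨ σ ⟩ᵛ) u ·· δ ≡ replaceᵛ (ts ·· τ) (p ⟨ τ ⟩ᵛ) (u · δ)
    replaceᵛ-·· (t ∷ ts) (here p) {σ} {δ} {τ} u h = cong₂ _∷_ (replace-· t p u h)
      (trans (··-assoc ts σ δ) (··-cong ts (λ x _ → h x)))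
    replaceᵛ-·· (t ∷ ts) (there p) {σ} {δ} {τ} u h = cong₂ _∷_ (·-factor t h) (replaceᵛ-·· ts p u h)

  properSubterm-· : ∀ {u t} δ → u ProperSubtermOf t → (u · δ) ProperSubtermOf (t · δ)
  properSubterm-· {t = t} δ (ε     , p≢ε , e) = ⊥-elim (p≢ε refl)
  properSubterm-· {t = t} δ (arg p , p≢ε , e) =
    arg p ⟨ δ ⟩ , (λ ()) , trans (∣-· t (arg p) δ) (cong (_· δ) e)

  mutual
    size-[] : ∀ C t → C ≡ □ ⊎ size t < size (C [ t ])
    size-[] □          t = inj₁ refl
    size-[] (fun f Cs) t = inj₂ (s≤s (ℕ.m≤n⇒m≤1+n (sizeᵛ-[]ᵛ Cs t)))

    sizeᵛ-[]ᵛ : ∀ {n} (Cs : Contexts n) t → size t ≤ sizeᵛ (Cs [ t ]ᵛ)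
    sizeᵛ-[]ᵛ (C ◂ ts) t = ℕ.≤-trans (size-≤[] C t) (ℕ.m≤m+n _ _)
    sizeᵛ-[]ᵛ (u ▸ Cs) t = ℕ.≤-trans (sizeᵛ-[]ᵛ Cs t) (ℕ.m≤n+m _ (size u))

    size-≤[] : ∀ C t → size t ≤ size (C [ t ])
    size-≤[] □ t = ℕ.≤-refl
    size-≤[] (fun f Cs) t = ℕ.m≤n⇒m≤o+n 2 (sizeᵛ-[]ᵛ Cs t)

  0<size : ∀ t → 0 < size t
  0<size (var x)    = s≤s z≤n
  0<size (fun f ts) = s≤s z≤n

  -- The strictness of size under instantiation by a non-variable relies on
  -- function symbols, constants included, weighing more than variables.
  mutual
    size-≤· : ∀ t σ → size t ≤ size (t · σ)
    size-≤· (var x)    σ = 0<size (σ x)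
    size-≤· (fun f ts) σ = s≤s (s≤s (sizeᵛ-≤·· ts σ))

    sizeᵛ-≤·· : ∀ {n} (ts : Vec Term n) σ → sizeᵛ ts ≤ sizeᵛ (ts ·· σ)
    sizeᵛ-≤·· []       σ = z≤n
    sizeᵛ-≤·· (t ∷ ts) σ = ℕ.+-mono-≤ (size-≤· t σ) (sizeᵛ-≤·· ts σ)

  mutual
    size-<· : ∀ t (p : Pos t) {σ x f us} → t ∣ p ≡ var x → σ x ≡ fun f us → size t < size (t · σ)
    size-<· t          ε       refl e′ rewrite e′ = s≤s (s≤s z≤n)
    size-<· (fun f ts) (arg p) e    e′ = s≤s (s≤s (sizeᵛ-<·· ts p e e′))

    sizeᵛ-<·· : ∀ {n} (ts : Vec Term n) (p : Posᵛ ts) {σ x f us} →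
      ts ∣ᵛ p ≡ var x → σ x ≡ fun f us → sizeᵛ ts < sizeᵛ (ts ·· σ)
    sizeᵛ-<·· (t ∷ ts) (here p)  {σ} e e′ = ℕ.+-mono-<-≤ (size-<· t p e e′) (sizeᵛ-≤·· ts σ)
    sizeᵛ-<·· (t ∷ ts) (there p) {σ} e e′ = ℕ.+-mono-≤-< (size-≤· t σ) (sizeᵛ-<·· ts p e e′)

  -- Since `t` is not the variable itself, the context around the occurrence is nonempty, and it
  -- stays so under `θ`.
  size-occurs : ∀ {x t} θ → x ∈Var t → t ≢ var x → size (θ x) < size (t · θ)
  size-occurs {x} {t} θ (p , e) t≢x with ∣⇒[] t p
  ... | □ , C[]≡t = ⊥-elim (t≢x (trans (sym C[]≡t) e))
  ... | C@(fun _ _) , C[]≡t with size-[] (C ·ᶜᵗˣ θ) (θ x)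
  ...   | inj₂ lt = subst (λ u → size (θ x) < size u)
            (trans (sym ([]-· C (var x) θ)) (cong (_· θ) (trans (cong (C [_]) (sym e)) C[]≡t))) lt

  rename : (𝓥 → 𝓥) → Subst
  rename ρ x = var (ρ x)

  mutual
    vars-rename : ∀ t ρ → vars (t · rename ρ) ≡ map ρ (vars t)
    vars-rename (var x)    ρ = refl
    vars-rename (fun f ts) ρ = varsᵛ-rename ts ρ

    varsᵛ-rename : ∀ {n} (ts : Vec Term n) ρ → varsᵛ (ts ·· rename ρ) ≡ map ρ (varsᵛ ts)
    varsᵛ-rename []       ρ = refl
    varsᵛ-rename (t ∷ ts) ρ = trans (cong₂ _++_ (vars-rename t ρ) (varsᵛ-rename ts ρ))
                                    (sym (map-++ ρ (vars t) (varsᵛ ts)))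

  mutual
    size-rename : ∀ t ρ → size (t · rename ρ) ≡ size t
    size-rename (var x)    ρ = refl
    size-rename (fun f ts) ρ = cong (2 +_) (sizeᵛ-rename ts ρ)

    sizeᵛ-rename : ∀ {n} (ts : Vec Term n) ρ → sizeᵛ (ts ·· rename ρ) ≡ sizeᵛ ts
    sizeᵛ-rename []       ρ = refl
    sizeᵛ-rename (t ∷ ts) ρ = cong₂ _+_ (size-rename t ρ) (sizeᵛ-rename ts ρ)

  ∈Var-rename : ∀ t ρ {x} → x ∈Var (t · rename ρ) → ∃ λ y → y ∈Var t × x ≡ ρ y
  ∈Var-rename t ρ x∈ with ∈-map⁻ ρ (subst (_ ∈ˡ_) (vars-rename t ρ) (∈Var⇒∈vars _ x∈))
  ... | y , y∈ , x≡ρy = y , ∈vars⇒∈Var t y∈ , x≡ρy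

  ⊵-refl : ∀ {t} → t ⊵ t
  ⊵-refl {t} = □ , var , sym (·-id t)

  []-·-assoc : ∀ C D t σ τ → C [ D [ t · σ ] · τ ] ≡ (C ∘ᶜ (D ·ᶜᵗˣ τ)) [ t · (σ ·ᶜ τ) ]
  []-·-assoc C D t σ τ = trans (cong (C [_]) (trans ([]-· D (t · σ) τ) (cong ((D ·ᶜᵗˣ τ) [_]) (·-assoc t σ τ))))
                               (sym (∘ᶜ-[] C (D ·ᶜᵗˣ τ) _))

  ⊵-trans : ∀ {s t u} → s ⊵ t → t ⊵ u → s ⊵ u
  ⊵-trans {u = u} (C , σ , refl) (D , τ , refl) = C ∘ᶜ (D ·ᶜᵗˣ σ) , τ ·ᶜ σ , []-·-assoc C D u τ σ

  step-close : ∀ {X s t} C σ → ⟶⟨ X ⟩ s t → ⟶⟨ X ⟩ (C [ s · σ ]) (C [ t · σ ])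
  step-close C σ (step {ℓ} {r} rule D τ refl refl) =
    step rule (C ∘ᶜ (D ·ᶜᵗˣ σ)) (τ ·ᶜ σ) ([]-·-assoc C D ℓ τ σ) ([]-·-assoc C D r τ σ)

  step-[] : ∀ {X s t} C → ⟶⟨ X ⟩ s t → ⟶⟨ X ⟩ (C [ s ]) (C [ t ])
  step-[] {X} C st = subst₂ ⟶⟨ X ⟩ (cong (C [_]) (·-id _)) (cong (C [_]) (·-id _)) (step-close C var st)

  step-rule : ∀ {X ℓ r} → X (ℓ , r) → ⟶⟨ X ⟩ ℓ r
  step-rule rule = step rule □ var (sym (·-id _)) (sym (·-id _))

  step-map : ∀ {X Y : Pairs} → (∀ {ℓ r} → X (ℓ , r) → Y (ℓ , r)) → ∀ {s t} → ⟶⟨ X ⟩ s t → ⟶⟨ Y ⟩ s t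
  step-map f (step rule C σ e e′) = step (f rule) C σ e e′

-- Well-foundedness of proper encompassment

module Encompassment (em : ExcludedMiddle 0ℓ) (𝓕 : Signature) (𝓥 : Set) where

  open Signature 𝓕
  open Rewriting 𝓕 𝓥
  open Terms 𝓕 𝓥

  #distinct : List 𝓥 → ℕ
  #distinct []       = 0
  #distinct (x ∷ xs) with em {x ∈ˡ xs}
  ... | yes _ = #distinct xs
  ... | no  _ = suc (#distinct xs)

  #distinct≤length : ∀ xs → #distinct xs ≤ length xs
  #distinct≤length []       = z≤n
  #distinct≤length (x ∷ xs) with em {x ∈ˡ xs}
  ... | yes _ = ℕ.m≤n⇒m≤1+n (#distinct≤length xs)
  ... | no  _ = s≤s (#distinct≤length xs)

  #distinct-map : ∀ (ρ : 𝓥 → 𝓥) xs → #distinct (map ρ xs) ≤ #distinct xs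
  #distinct-map ρ []       = z≤n
  #distinct-map ρ (x ∷ xs) with em {x ∈ˡ xs} | em {ρ x ∈ˡ map ρ xs}
  ... | yes _  | yes _   = #distinct-map ρ xs
  ... | yes x∈ | no ρx∉  = ⊥-elim (ρx∉ (∈-map⁺ ρ x∈))
  ... | no _   | yes _   = ℕ.m≤n⇒m≤1+n (#distinct-map ρ xs)
  ... | no _   | no _    = s≤s (#distinct-map ρ xs)

  InjectiveOn : (𝓥 → 𝓥) → List 𝓥 → Set
  InjectiveOn ρ xs = ∀ {x y} → x ∈ˡ xs → y ∈ˡ xs → ρ x ≡ ρ y → x ≡ y

  -- A pigeonhole argument: if `z` is new but `ρ z` already occurs, the count drops, against the
  -- assumption. So `z` and `ρ z` are new together, and the tail inherits the bound.
  #distinct-injective : ∀ ρ xs → #distinct xs ≤ #distinct (map ρ xs) → InjectiveOn ρ xs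
  #distinct-injective ρ (z ∷ xs) le with em {z ∈ˡ xs} | em {ρ z ∈ˡ map ρ xs}
  ... | no _   | yes _   = ⊥-elim (ℕ.<-irrefl refl (ℕ.≤-trans le (#distinct-map ρ xs)))
  ... | yes z∈ | no ρz∉  = ⊥-elim (ρz∉ (∈-map⁺ ρ z∈))
  ... | yes z∈ | yes _   = λ x∈ y∈ → #distinct-injective ρ xs le (absorb x∈) (absorb y∈)
    where
    absorb : ∀ {x} → x ∈ˡ z ∷ xs → x ∈ˡ xs
    absorb (here refl) = z∈
    absorb (there x∈)  = x∈
  ... | no z∉  | no ρz∉  = inj
    where
    inj : InjectiveOn ρ (z ∷ xs)
    inj (here refl) (here refl) e = refl
    inj (here refl) (there y∈)  e = ⊥-elim (ρz∉ (subst (_∈ˡ map ρ xs) (sym e) (∈-map⁺ ρ y∈)))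
    inj (there x∈)  (here refl) e = ⊥-elim (ρz∉ (subst (_∈ˡ map ρ xs) e (∈-map⁺ ρ x∈)))
    inj (there x∈)  (there y∈)  e = #distinct-injective ρ xs (s≤s⁻¹ le) x∈ y∈ e

  rename-invertible : ∀ t ρ → InjectiveOn ρ (vars t) → ∃ λ ρ⁻¹ → t · rename ρ · rename ρ⁻¹ ≡ t
  rename-invertible t ρ inj = ρ⁻¹ , trans (·-assoc t (rename ρ) (rename ρ⁻¹))
      (trans (·-cong t (λ x x∈ → cong var (cancel x (∈Var⇒∈vars t x∈)))) (·-id t))
    where
    ρ⁻¹ : 𝓥 → 𝓥
    ρ⁻¹ y with em {∃ λ x → x ∈ˡ vars t × ρ x ≡ y}
    ... | yes (x , _) = x
    -- An arbitrary value: only images of variables of `t` are ever inverted.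
    ... | no  _       = y

    cancel : ∀ x → x ∈ˡ vars t → ρ⁻¹ (ρ x) ≡ x
    cancel x x∈ with em {∃ λ z → z ∈ˡ vars t × ρ z ≡ ρ x}
    ... | yes (z , z∈ , e) = inj z∈ x∈ e
    ... | no  ¬∃           = ⊥-elim (¬∃ (x , x∈ , refl))

  -- If no two variables of `t` were identified, `ρ` could be undone on `t`, and `t` would encompass
  -- its own renaming, against properness.
  rename-▷ : ∀ t ρ → (t · rename ρ) ▷ t → #distinct (vars (t · rename ρ)) < #distinct (vars t)
  rename-▷ t ρ (_ , ¬t⊵tρ) = ℕ.≰⇒> λ le →
    let ρ⁻¹ , e = rename-invertible t ρ
                    (#distinct-injective ρ (vars t) (subst (λ xs → #distinct (vars t) ≤ #distinct xs) (vars-rename t ρ) le))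
    in ¬t⊵tρ (□ , rename ρ⁻¹ , sym e)

  -- The number of repeated variable occurrences. A renaming keeps the number of occurrences, so
  -- identifying variables makes this grow, as a measure for `▷` must.
  missing : Term → ℕ
  missing t = length (vars t) ∸ #distinct (vars t)

  -- A nonempty context increases the size, and so does a substitution that maps some variable of
  -- `t` to a non-variable. Otherwise `s` is a renaming of `t`, and properness forces variables to
  -- be identified.
  ▷-measure : ∀ {s t} → s ▷ t → ×-Lex _≡_ _<_ _<_ (size t , missing t) (size s , missing s)
  ▷-measure {t = t} s▷t@((C , σ , refl) , _) with size-[] C (t · σ)
  ... | inj₂ lt   = inj₁ (ℕ.≤-<-trans (size-≤· t σ) lt)
  ... | inj₁ refl with em {∃ λ x → x ∈Var t × ∃₂ λ f us → σ x ≡ fun f us}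
  ...   | yes (x , (p , e) , _ , _ , e′) = inj₁ (size-<· t p e e′)
  ...   | no ¬∃ = inj₂ (sym (trans (cong size tσ≡tρ) (size-rename t ρ)) , lt)
    where
    ρ : 𝓥 → 𝓥
    ρ x with σ x
    ... | var y   = y
    -- A default value: by `¬∃` this case does not arise for variables of `t`.
    ... | fun _ _ = x

    σ≡ρ : ∀ x → x ∈Var t → σ x ≡ var (ρ x)
    σ≡ρ x x∈ with σ x in e
    ... | var y   = refl
    ... | fun f us = ⊥-elim (¬∃ (x , x∈ , f , us , e))

    tσ≡tρ : t · σ ≡ t · rename ρ
    tσ≡tρ = ·-cong t σ≡ρ

    lt : missing t < missing (t · σ)
    lt rewrite tσ≡tρ | vars-rename t ρ | length-map ρ (vars t) =
      ℕ.∸-monoʳ-< (subst (λ xs → #distinct xs < #distinct (vars t)) (vars-rename t ρ) (rename-▷ t ρ (subst (_▷ t) tσ≡tρ s▷t)))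
                  (#distinct≤length (vars t))

  ▷-wellFounded : WellFounded (flip _▷_)
  ▷-wellFounded = Subrelation.wellFounded ▷-measure
    (On.wellFounded (λ t → size t , missing t) (×-wellFounded <-wellFounded <-wellFounded))

-- Most general unifiers and renaming apart

module Unification (em : ExcludedMiddle 0ℓ) (𝓕 : Signature) (𝓥 : Set) where

  open Signature 𝓕
  open Rewriting 𝓕 𝓥
  open Terms 𝓕 𝓥

  _[_≔_] : Subst → 𝓥 → Term → Subst
  (σ [ x ≔ t ]) y with em {y ≡ x}
  ... | yes _ = t
  ... | no  _ = σ y

  ≔-same : ∀ σ x t → (σ [ x ≔ t ]) x ≡ t
  ≔-same σ x t with em {x ≡ x}
  ... | yes _  = refl
  ... | no x≢x = ⊥-elim (x≢x refl)

  infix 8 _↦_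

  _↦_ : 𝓥 → Term → Subst
  x ↦ t = var [ x ≔ t ]

  ↦-fresh : ∀ x t u → ¬ (x ∈Var u) → u · (x ↦ t) ≡ u
  ↦-fresh x t u x∉ = trans (·-cong u fixed) (·-id u)
    where
    fixed : ∀ y → y ∈Var u → (x ↦ t) y ≡ var y
    fixed y y∈ with em {y ≡ x}
    ... | yes refl = ⊥-elim (x∉ y∈)
    ... | no _     = refl

  ↦-absorbed : ∀ x t θ → θ x ≡ t · θ → ∀ u → u · (x ↦ t) · θ ≡ u · θ
  ↦-absorbed x t θ e u = trans (·-assoc u (x ↦ t) θ) (·-cong u (λ y _ → absorb y))
    where
    absorb : ∀ y → (x ↦ t) y · θ ≡ θ y
    absorb y with em {y ≡ x}
    ... | yes refl = sym e
    ... | no _     = refl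

  Problem : Set
  Problem = List (Term × Term)

  Unifies : Subst → Problem → Set
  Unifies σ = All (λ (s , t) → IsUnifier σ s t)

  -- The factor witnessing generality can be τ itself, as for idempotent σ.
  MostGeneral : Subst → Problem → Set
  MostGeneral σ P = Unifies σ P × (∀ τ → Unifies τ P → ∀ x → τ x ≡ σ x · τ)

  -- Counting left-hand sides suffices: the measure is used only for a `θ` that unifies the problem,
  -- so both sides have the same instance.
  weight : Subst → Problem → ℕ
  weight θ []            = 0
  weight θ ((s , t) ∷ P) = size (s · θ) + weight θ P

  instantiate : Subst → Problem → Problem
  instantiate ρ = map (λ (s , t) → s · ρ , t · ρ)

  unifies-instantiate : ∀ {ρ θ} P → (∀ u → u · ρ · θ ≡ u · θ) → Unifies θ P → Unifies θ (instantiate ρ P)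
  unifies-instantiate []            h []       = []
  unifies-instantiate ((s , t) ∷ P) h (e ∷ es) =
    trans (h s) (trans e (sym (h t))) ∷ unifies-instantiate P h es

  instantiate-unifies : ∀ {ρ σ} P → Unifies σ (instantiate ρ P) → Unifies (ρ ·ᶜ σ) P
  instantiate-unifies []            []       = []
  instantiate-unifies {ρ} {σ} ((s , t) ∷ P) (e ∷ es) =
    trans (sym (·-assoc s ρ σ)) (trans e (·-assoc t ρ σ)) ∷ instantiate-unifies P es

  weight-instantiate : ∀ {ρ θ} P → (∀ u → u · ρ · θ ≡ u · θ) → weight θ (instantiate ρ P) ≡ weight θ P
  weight-instantiate []            h = refl
  weight-instantiate ((s , t) ∷ P) h = cong₂ _+_ (cong size (h s)) (weight-instantiate P h)

  mostGeneral-swap : ∀ {σ s t P} → MostGeneral σ ((s , t) ∷ P) → MostGeneral σ ((t , s) ∷ P)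
  mostGeneral-swap (e ∷ es , g) = sym e ∷ es , λ { τ (e′ ∷ es′) → g τ (sym e′ ∷ es′) }

  -- A unifier of `x` and `t` absorbs the substitution `x ↦ t`, so it also unifies the instantiated
  -- problem, where generality of `σ` applies. The occurs check makes `t` invariant under `x ↦ t`,
  -- so that the first equation is solved.
  mostGeneral-eliminate : ∀ {σ x t P} → ¬ (x ∈Var t) →
    MostGeneral σ (instantiate (x ↦ t) P) → MostGeneral ((x ↦ t) ·ᶜ σ) ((var x , t) ∷ P)
  mostGeneral-eliminate {σ} {x} {t} {P} x∉t (es , g) = e ∷ instantiate-unifies P es , general
    where
    e : ((x ↦ t) ·ᶜ σ) x ≡ t · ((x ↦ t) ·ᶜ σ)
    e = trans (cong (_· σ) (trans (≔-same var x t) (sym (↦-fresh x t t x∉t)))) (·-assoc t (x ↦ t) σ)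

    general : ∀ τ → Unifies τ ((var x , t) ∷ P) → ∀ y → τ y ≡ (x ↦ t) y · σ · τ
    general τ (e ∷ es′) y = trans (sym (absorb (var y)))
        (trans (·-cong ((x ↦ t) y) (λ z _ → g τ (unifies-instantiate P absorb es′) z))
               (sym (·-assoc ((x ↦ t) y) σ τ)))
      where absorb = ↦-absorbed x t τ e

  infixr 5 _,,_

  _,,_ : ∀ {n} → Vec Term n × Vec Term n → Problem → Problem
  ([]     , []    ) ,, P = P
  (t ∷ ts , u ∷ us) ,, P = (t , u) ∷ ((ts , us) ,, P)

  ,,-unifies : ∀ {n θ P} (ts us : Vec Term n) → ts ·· θ ≡ us ·· θ → Unifies θ P → Unifies θ ((ts , us) ,, P)
  ,,-unifies []       []       e es = es
  ,,-unifies (t ∷ ts) (u ∷ us) e es =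
    proj₁ (∷-injective e) ∷ ,,-unifies ts us (proj₂ (∷-injective e)) es

  unifies-,, : ∀ {n θ P} (ts us : Vec Term n) → Unifies θ ((ts , us) ,, P) → ts ·· θ ≡ us ·· θ × Unifies θ P
  unifies-,, []       []       es       = refl , es
  unifies-,, (t ∷ ts) (u ∷ us) (e ∷ es) = let e′ , es′ = unifies-,, ts us es in cong₂ _∷_ e e′ , es′

  weight-,, : ∀ {n} θ (ts us : Vec Term n) P → weight θ ((ts , us) ,, P) ≡ sizeᵛ (ts ·· θ) + weight θ P
  weight-,, θ []       []       P = refl
  weight-,, θ (t ∷ ts) (u ∷ us) P = trans (cong (size (t · θ) +_) (weight-,, θ ts us P))
                                          (sym (ℕ.+-assoc (size (t · θ)) _ _))

  occurs-check : ∀ {x t} θ → θ x ≡ t · θ → t ≢ var x → ¬ (x ∈Var t)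
  occurs-check θ e t≢x x∈t = ℕ.<-irrefl (cong size e) (size-occurs θ x∈t t≢x)

  -- Eliminating a variable does not change the instance of the problem by the
  -- known unifier θ, so the size of that instance decreases in every step.
  solve : ∀ θ P → Unifies θ P → Acc _<_ (weight θ P) → ∃ λ σ → MostGeneral σ P
  solve-var : ∀ θ x t P → θ x ≡ t · θ → Unifies θ P →
    ∀ {n} → size (θ x) + weight θ P ≡ n → Acc _<_ n → ∃ λ σ → MostGeneral σ ((var x , t) ∷ P)

  solve θ []                         _        _  = var , [] , λ _ _ _ → refl
  solve θ ((var x    , t       ) ∷ P) (e ∷ es) a = solve-var θ x t P e es refl a
  solve θ ((fun f ts , var x   ) ∷ P) (e ∷ es) a =
    -- Swapping the two sides leaves the weight unchanged because `θ` equates them.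
    let σ , m = solve-var θ x (fun f ts) P (sym e) es (cong (λ u → size u + weight θ P) (sym e)) a
    in σ , mostGeneral-swap m
  solve θ ((fun f ts , fun g us) ∷ P) (e ∷ es) (acc rs) with fun-symbol e
  ... | refl =
    let σ , es′ , m = solve θ ((ts , us) ,, P) (,,-unifies ts us (fun-injective e) es)
          -- Decomposition saves exactly the 2 that `size` charges for the function symbol.
          (rs (subst (_< weight θ ((fun f ts , fun g us) ∷ P)) (sym (weight-,, θ ts us P)) (ℕ.m<n+m _ {2} (s≤s z≤n))))
        e″ , es″ = unifies-,, ts us es′
    in σ , cong (fun f) e″ ∷ es″ , λ { τ (e ∷ es) → m τ (,,-unifies ts us (fun-injective e) es) }

  solve-var θ x t P e es refl (acc rs) with em {t ≡ var x}
  ... | yes refl =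
    let σ , es′ , m = solve θ P es (rs (ℕ.m<n+m (weight θ P) (0<size (θ x))))
    in σ , refl ∷ es′ , λ { τ (_ ∷ es) → m τ es }
  ... | no t≢x =
    let absorb = ↦-absorbed x t θ e
        σ , m  = solve θ (instantiate (x ↦ t) P) (unifies-instantiate P absorb es)
          (rs (subst (_< size (θ x) + weight θ P) (sym (weight-instantiate P absorb)) (ℕ.m<n+m (weight θ P) (0<size (θ x)))))
    in (x ↦ t) ·ᶜ σ , mostGeneral-eliminate (occurs-check θ e t≢x) m

  mgu-exists : ∀ {s t} θ → IsUnifier θ s t → ∃ λ σ → IsMGU σ s t
  mgu-exists {s} {t} θ e with solve θ ((s , t) ∷ []) (e ∷ []) (<-wellFounded _)
  ... | σ , (e′ ∷ []) , m = σ , e′ , λ τ u → τ , m τ (u ∷ [])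

  -- Renaming apart by transpositions

  transpose : 𝓥 → 𝓥 → 𝓥 → 𝓥
  transpose a b x with em {x ≡ a} | em {x ≡ b}
  ... | yes _ | _     = b
  ... | no _  | yes _ = a
  ... | no _  | no _  = x

  transpose-left : ∀ a b → transpose a b a ≡ b
  transpose-left a b with em {a ≡ a} | em {a ≡ b}
  ... | yes _   | _ = refl
  ... | no a≢a | _ = ⊥-elim (a≢a refl)

  transpose-other : ∀ {a b x} → x ≢ a → x ≢ b → transpose a b x ≡ x
  transpose-other {a} {b} {x} x≢a x≢b with em {x ≡ a} | em {x ≡ b}
  ... | yes e | _     = ⊥-elim (x≢a e)
  ... | no _  | yes e = ⊥-elim (x≢b e)
  ... | no _  | no _  = refl

  transpose-involutive : ∀ a b x → transpose a b (transpose a b x) ≡ x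
  transpose-involutive a b x with em {x ≡ a} | em {x ≡ b}
  ... | no x≢a   | no x≢b   = transpose-other x≢a x≢b
  ... | no _     | yes refl = transpose-left a b
  ... | yes refl | _ with em {b ≡ a} | em {b ≡ b}
  ...   | yes b≡a | _       = b≡a
  ...   | no _    | yes _   = refl
  ...   | no _    | no b≢b  = ⊥-elim (b≢b refl)

  -- If the bijection built so far sends `x` into `avoid`, it is followed by the transposition of
  -- that image with some `z` outside `avoid` and outside the images of `xs`. The images of `xs` are
  -- then untouched.
  rename-apart : Infinite 𝓥 → (avoid xs : List 𝓥) →
    ∃ λ (ρ : 𝓥 ↔ 𝓥) → ∀ {x} → x ∈ˡ xs → Inverse.to ρ x ∉ˡ avoid
  rename-apart inf avoid []       = ↔-id 𝓥 , λ ()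
  rename-apart inf avoid (x ∷ xs) with rename-apart inf avoid xs
  ... | ρ , apart with em {Inverse.to ρ x ∈ˡ avoid}
  ...   | no ρx∉  = ρ , λ { (here refl) → ρx∉ ; (there y∈) → apart y∈ }
  ...   | yes ρx∈ with inf (avoid ++ map (Inverse.to ρ) xs)
  ...     | z , z∉ = mk↔ₛ′ swap swap (transpose-involutive _ z) (transpose-involutive _ z) ↔-∘ ρ , apart′
    where
    swap : 𝓥 → 𝓥
    swap = transpose (Inverse.to ρ x) z

    apart′ : ∀ {y} → y ∈ˡ x ∷ xs → swap (Inverse.to ρ y) ∉ˡ avoid
    apart′ (here refl) = subst (_∉ˡ avoid) (sym (transpose-left _ z)) (z∉ ∘ ∈-++⁺ˡ)
    apart′ (there {xs = xs} y∈) = subst (_∉ˡ avoid)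
      (sym (transpose-other (λ e → apart y∈ (subst (_∈ˡ avoid) (sym e) ρx∈))
                            (λ e → z∉ (∈-++⁺ʳ avoid (subst (_∈ˡ map (Inverse.to ρ) xs) e (∈-map⁺ (Inverse.to ρ) y∈))))))
      (apart y∈)

-- Rewrite steps

module Steps (em : ExcludedMiddle 0ℓ) (𝓕 : Signature) (𝓥 : Set) where

  open Signature 𝓕
  open Rewriting 𝓕 𝓥
  open Terms 𝓕 𝓥
  open Unification em 𝓕 𝓥 using (_[_≔_]; ≔-same)

  -- `W` stands for a function symbol some of whose leading arguments are already supplied.
  -- Recursion along an argument vector loses the arity of the symbol; this property retains that a
  -- hole in the remaining arguments is a hole in a term.
  record FillsArguments {n} (W : Vec Term n → Term) : Set where
    field
      fill : ∀ Cs → ∃ λ C → ∀ t → W (Cs [ t ]ᵛ) ≡ C [ t ]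

  open FillsArguments public

  fun-fills : ∀ f → FillsArguments (Term.fun f)
  fun-fills f .fill Cs = fun f Cs , λ _ → refl

  ∷-fills : ∀ {n} {W : Vec Term (suc n) → Term} u → FillsArguments W → FillsArguments (λ ts → W (u ∷ ts))
  ∷-fills u fills .fill Cs = fill fills (u ▸ Cs)

  step-fill : ∀ {X n} {W : Vec Term n → Term} → FillsArguments W → ∀ Cs {s t} →
    ⟶⟨ X ⟩ s t → ⟶⟨ X ⟩ (W (Cs [ s ]ᵛ)) (W (Cs [ t ]ᵛ))
  step-fill {X} fills Cs {s} {t} st with fill fills Cs
  ... | C , eq = subst₂ ⟶⟨ X ⟩ (sym (eq s)) (sym (eq t)) (step-[] C st)

  -- The arguments are rewritten from left to right, those already finished being absorbed into `W`.
  steps-arguments : ∀ {X n} {W : Vec Term n → Term} → FillsArguments W → ∀ {ts us} →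
    Pointwise ⟶*⟨ X ⟩ ts us → ⟶*⟨ X ⟩ (W ts) (W us)
  steps-arguments fills []                        = ε
  steps-arguments {W = W} fills (_∷_ {y = u} {xs = ts} st sts) =
    Star.gmap (λ v → W (v ∷ ts)) (step-fill fills (□ ◂ ts)) st ◅◅
    steps-arguments (∷-fills u fills) sts

  mutual
    ·-steps : ∀ {X} t {σ τ} → (∀ x → ⟶*⟨ X ⟩ (σ x) (τ x)) → ⟶*⟨ X ⟩ (t · σ) (t · τ)
    ·-steps (var x)    h = h x
    ·-steps (fun f ts) h = steps-arguments (fun-fills f) (··-steps ts h)

    ··-steps : ∀ {X n} (ts : Vec Term n) {σ τ} → (∀ x → ⟶*⟨ X ⟩ (σ x) (τ x)) →
      Pointwise ⟶*⟨ X ⟩ (ts ·· σ) (ts ·· τ)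
    ··-steps []       h = []
    ··-steps (t ∷ ts) h = ·-steps t h ∷ ··-steps ts h

  ≔-steps : ∀ {X} σ x t → ⟶*⟨ X ⟩ (σ x) t → ∀ y → ⟶*⟨ X ⟩ (σ y) ((σ [ x ≔ t ]) y)
  ≔-steps σ x t st y with em {y ≡ x}
  ... | yes refl = st
  ... | no _     = ε

  -- The hole of a context D with l · σ ≡ D [ a ] lies either at a non-variable
  -- position of l or inside σ x for a variable x of l; in the latter case
  -- rewriting the remaining copies of σ x turns D [ b ] into an instance of l.
  data Located (X : Pairs) (l : Term) (σ : Subst) (D : Context) (a : Term) : Set where
    at-function : (p : Pos l) → (∀ x → l ∣ p ≢ var x) → (l ∣ p) · σ ≡ a →
      (∀ b → D [ b ] ≡ replace (l · σ) (p ⟨ σ ⟩) b) → Located X l σ D a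
    in-variable : ∀ x D′ → σ x ≡ D′ [ a ] →
      (∀ b → ⟶⟨ X ⟩ a b → ⟶*⟨ X ⟩ (D [ b ]) (l · (σ [ x ≔ D′ [ b ] ]))) → Located X l σ D a

  data Locatedᵛ (X : Pairs) {n} (ls : Vec Term n) (σ : Subst) (Ds : Contexts n) (a : Term) : Set where
    at-function : (p : Posᵛ ls) → (∀ x → ls ∣ᵛ p ≢ var x) → (ls ∣ᵛ p) · σ ≡ a →
      (∀ b → Ds [ b ]ᵛ ≡ replaceᵛ (ls ·· σ) (p ⟨ σ ⟩ᵛ) b) → Locatedᵛ X ls σ Ds a
    in-variable : ∀ x D′ → σ x ≡ D′ [ a ] →
      (∀ b → ⟶⟨ X ⟩ a b → Pointwise ⟶*⟨ X ⟩ (Ds [ b ]ᵛ) (ls ·· (σ [ x ≔ D′ [ b ] ]))) → Locatedᵛ X ls σ Ds a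

  mutual
    locate : ∀ X l σ D {a} → l · σ ≡ D [ a ] → Located X l σ D a
    locate X (var x)    σ D e =
      in-variable x D e λ b _ → subst (⟶*⟨ X ⟩ (D [ b ])) (sym (≔-same σ x _)) ε
    locate X (fun f ls) σ □ e = at-function ε (λ _ ()) e λ _ → refl
    locate X (fun f ls) σ (fun g Ds) e with fun-symbol e
    ... | refl with locateᵛ X ls σ Ds (fun-injective e)
    ...   | at-function p nv e′ h = at-function (arg p) nv e′ λ b → cong (fun f) (h b)
    ...   | in-variable x D′ e′ h = in-variable x D′ e′ λ b ab → steps-arguments (fun-fills f) (h b ab)

    locateᵛ : ∀ X {n} (ls : Vec Term n) σ Ds {a} → ls ·· σ ≡ Ds [ a ]ᵛ → Locatedᵛ X ls σ Ds a
    locateᵛ X (l ∷ ls) σ (D ◂ us) {a} e with ∷-injective e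
    ... | e₁ , refl with locate X l σ D e₁
    ...   | at-function p nv e′ h = at-function (here p) nv e′ λ b → cong (_∷ _) (h b)
    ...   | in-variable x D′ e′ h = in-variable x D′ e′ λ b ab →
              -- The arguments beside the hole still contain the old `σ x`, so each of its copies is
              -- rewritten there.
              h b ab ∷ ··-steps ls (≔-steps σ x _ (subst (λ u → ⟶*⟨ X ⟩ u (D′ [ b ])) (sym e′) (step-[] D′ ab ◅ ε)))
    locateᵛ X (l ∷ ls) σ (u ▸ Ds) e with ∷-injective e
    ... | refl , e₂ with locateᵛ X ls σ Ds e₂
    ...   | at-function p nv e′ h = at-function (there p) nv e′ λ b → cong (_ ∷_) (h b)
    ...   | in-variable x D′ e′ h = in-variable x D′ e′ λ b ab →
              ·-steps l (≔-steps σ x _ (subst (λ u → ⟶*⟨ X ⟩ u (D′ [ b ])) (sym e′) (step-[] D′ ab ◅ ε))) ∷ h b ab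

  mutual
    hole : ∀ C t → ∃ λ (p : Pos (C [ t ])) → C [ t ] ∣ p ≡ t
    hole □          t = ε , refl
    hole (fun f Cs) t = let p , e = holeᵛ Cs t in arg p , e

    holeᵛ : ∀ {n} (Cs : Contexts n) t → ∃ λ (p : Posᵛ (Cs [ t ]ᵛ)) → Cs [ t ]ᵛ ∣ᵛ p ≡ t
    holeᵛ (C ◂ ts) t = let p , e = hole C t in here p , e
    holeᵛ (u ▸ Cs) t = let p , e = holeᵛ Cs t in there p , e

  argument-properSubterm : ∀ f Cs t → t ProperSubtermOf (Context.fun f Cs [ t ])
  argument-properSubterm f Cs t = let p , e = holeᵛ Cs t in arg p , (λ ()) , e

  properSubterm-size : ∀ {u t} → u ProperSubtermOf t → size u < size t
  properSubterm-size (ε , p≢ε , _) = ⊥-elim (p≢ε refl)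
  properSubterm-size {t = t@(fun f ts)} (arg p , _ , refl) with contextᵛ ts p
  ... | Cs , h = subst (λ v → size (ts ∣ᵛ p) < 2 + sizeᵛ v) (trans (h _) (replaceᵛ-∣ ts p))
                       (s≤s (ℕ.m≤n⇒m≤1+n (sizeᵛ-[]ᵛ Cs (ts ∣ᵛ p))))

  Reducible : Pairs → Term → Set
  Reducible X t = ∃ λ u → ⟶⟨ X ⟩ t u

  InnermostRedex : Pairs → Term → Set
  InnermostRedex X t = ∀ u → u ProperSubtermOf t → IsNormalForm ⟶⟨ X ⟩ u

  record InnermostStep (X : Pairs) (s : Term) : Set where
    constructor innermost
    field
      {ℓ r}   : Term
      rule    : X (ℓ , r)
      C       : Context
      σ       : Subst
      s≡      : s ≡ C [ ℓ · σ ]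
      isInnermost : InnermostRedex X (ℓ · σ)

  -- Descending into a reducible proper subterm lowers the size. When there is none, the given step
  -- must take place at the root.
  innermost-step : ∀ {X} s → Reducible X s → Acc _<_ (size s) → InnermostStep X s
  innermost-step {X} s red (acc rs) with em {∃ λ u → u ProperSubtermOf s × Reducible X u}
  innermost-step {X} s red (acc rs) | yes (u , sub@(p , _ , refl) , red′) =
    let innermost rule D σ e inn = innermost-step u red′ (rs (properSubterm-size sub))
        C , C[u]≡s = ∣⇒[] s p
    in innermost rule (C ∘ᶜ D) σ (trans (sym C[u]≡s) (trans (cong (C [_]) e) (sym (∘ᶜ-[] C D _)))) inn
  innermost-step s (_ , step rule □ σ refl _) (acc rs) | no ¬inner =
    innermost rule □ σ refl λ u sub red → ¬inner (u , sub , red)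
  innermost-step s (_ , step {ℓ} {r} rule (fun f Cs) σ refl _) (acc rs) | no ¬inner =
    ⊥-elim (¬inner (ℓ · σ , argument-properSubterm f Cs (ℓ · σ) , r · σ , step rule □ σ refl refl))

-- Confluence from prime critical pairs

module Ordered (em : ExcludedMiddle 0ℓ) (𝓕 : Signature) (𝓥 : Set)
  (_>_ : Rel (Rewriting.Term 𝓕 𝓥) 0ℓ) (isReductionOrder : Rewriting.IsReductionOrder 𝓕 𝓥 _>_) where

  open Signature 𝓕
  open Rewriting 𝓕 𝓥
  open Terms 𝓕 𝓥
  open Encompassment em 𝓕 𝓥 using (▷-wellFounded)
  open Unification em 𝓕 𝓥
  open Steps em 𝓕 𝓥
  open IsReductionOrder isReductionOrder

  >-trans : ∀ {s t u} → s > t → t > u → s > u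
  >-trans = IsStrictPartialOrder.trans isStrictPartialOrder

  -- Iterating `f` on `t > f t` would give an infinite descent `t > f t > f (f t) > ...`.
  monotone⇒¬> : (f : Term → Term) → (∀ {s t} → s > t → f s > f t) → ∀ t → ¬ (t > f t)
  monotone⇒¬> f mono t = descend (wellFounded t)
    where
    descend : ∀ {t} → Acc (flip _>_) t → ¬ (t > f t)
    descend (acc rs) t>ft = descend (rs t>ft) (mono t>ft)

  infix 4 _≻_

  _≻_ : Rel Term 0ℓ
  s ≻ t = (∃ λ u → s > u × u ⊵ t) ⊎ s ▷ t

  -- Works because > is closed under contexts and substitutions, so that
  -- a >-step below ⊵ can be moved above it.
  ≻-wellFounded : WellFounded (flip _≻_)
  ≻-wellFounded t = below (wellFounded t) ⊵-refl (▷-wellFounded t)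
    where
    mutual
      below : ∀ {t u} → Acc (flip _>_) t → t ⊵ u → Acc (flip _▷_) u → Acc (flip _≻_) u
      below a t⊵u a′ = acc (below′ a t⊵u a′)

      below′ : ∀ {t u v} → Acc (flip _>_) t → t ⊵ u → Acc (flip _▷_) u → u ≻ v → Acc (flip _≻_) v
      -- Lifting `u > w` through `C` and `σ` lowers the outer term, so accessibility for `▷` may
      -- start afresh; a step of the other kind keeps the outer term and lowers the inner one.
      below′ {v = v} (acc rs) (C , σ , refl) _ (inj₁ (w , u>w , w⊵v)) =
        below (rs (closed-context C (closed-subst σ u>w))) (⊵-trans {u = v} (C , σ , refl) w⊵v) (▷-wellFounded _)
      below′ {v = v} a t⊵u (acc rs′) (inj₂ u▷v) = below a (⊵-trans {u = v} t⊵u (proj₁ u▷v)) (rs′ u▷v)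

  Decreasing : Pairs → Set
  Decreasing X = ∀ {ℓ r} → X (ℓ , r) → ℓ > r

  module _ {X : Pairs} (decreasing : Decreasing X) where

    step⇒> : ∀ {s t} → ⟶⟨ X ⟩ s t → s > t
    step⇒> (step rule C σ refl refl) = closed-context C (closed-subst σ (decreasing rule))

    decreasing⇒terminating : StronglyNormalizing ⟶⟨ X ⟩
    decreasing⇒terminating = Subrelation.wellFounded step⇒> wellFounded

    decreasing⇒isTRS : IsTRS X
    decreasing⇒isTRS = record { lhs-nonvar = lhs-nonvar ; rhs-vars = rhs-vars }
      where
      lhs-nonvar : ∀ {ℓ r} → X (ℓ , r) → ∀ x → ℓ ≢ var x
      lhs-nonvar {r = r} rule x refl =
        -- Substituting `r` for every variable turns `var x > r` into `r > r · σ` with the same `σ`,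
        -- which can be iterated.
        monotone⇒¬> (_· (λ _ → r)) (closed-subst _) r (closed-subst (λ _ → r) (decreasing rule))

      rhs-vars : ∀ {ℓ r} → X (ℓ , r) → ∀ {x} → x ∈Var r → x ∈Var ℓ
      rhs-vars {ℓ} {r} rule {x} (p , e) with em {x ∈Var ℓ}
      ... | yes x∈ℓ = x∈ℓ
      ... | no  x∉ℓ with ∣⇒[] r p
      -- Substituting `ℓ` for the extra variable `x` fixes the left-hand side and yields
      -- `ℓ > D [ ℓ ]`, which can be iterated.
      ...   | C , C[x]≡r = ⊥-elim (monotone⇒¬> (D [_]) (closed-context D) ℓ
                (subst₂ _>_ (↦-fresh x ℓ ℓ x∉ℓ) rσ≡D[ℓ] (closed-subst (x ↦ ℓ) (decreasing rule))))
        where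
        D : Context
        D = C ·ᶜᵗˣ (x ↦ ℓ)
        rσ≡D[ℓ] : r · (x ↦ ℓ) ≡ D [ ℓ ]
        rσ≡D[ℓ] = trans (cong (_· (x ↦ ℓ)) (trans (sym C[x]≡r) (cong (C [_]) e)))
                    (trans ([]-· C (var x) (x ↦ ℓ)) (cong (D [_]) (≔-same var x ℓ)))

  -- Connectedness below a bound

  Conversion : Pairs → (Term → Set) → Rel Term 0ℓ
  Conversion X B = Star (λ s t → ⟷⟨ X ⟩ s t × B s × B t)

  conversion-sym : ∀ {X B s t} → Conversion X B s t → Conversion X B t s
  conversion-sym {X} = Star.reverse λ (st , bs , bt) → Sym.symmetric ⟶⟨ X ⟩ st , bt , bs

  conversion-[] : ∀ {X s t u} C → Conversion X (s >_) t u → Conversion X ((C [ s ]) >_) (C [ t ]) (C [ u ])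
  conversion-[] C = Star.gmap (C [_]) λ (st , s>t , s>u) →
    Sym.gmap (C [_]) (step-[] C) st , closed-context C s>t , closed-context C s>u

  module _ {X : Pairs} (decreasing : Decreasing X) where

    steps⇒conversion : ∀ {w s t} → w > s → ⟶*⟨ X ⟩ s t → Conversion X (w >_) s t
    steps⇒conversion w>s ε          = ε
    steps⇒conversion w>s (st ◅ sts) =
      let w>t = >-trans w>s (step⇒> decreasing st)
      in (fwd st , w>s , w>t) ◅ steps⇒conversion w>t sts

    joinable⇒conversion : ∀ {w s t} → w > s → w > t → ↓⟨ X ⟩ s t → Conversion X (w >_) s t
    joinable⇒conversion w>s w>t (_ , su , tu) =
      steps⇒conversion w>s su ◅◅ conversion-sym (steps⇒conversion w>t tu)

    -- Connectedness below the source of a peak, in the sense of Winkler and Buchberger.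
    PeaksConnected : Set
    PeaksConnected = ∀ {s t u} → ⟶⟨ X ⟩ s t → ⟶⟨ X ⟩ s u → Conversion X (s >_) t u

    connected⇒confluent : PeaksConnected → Confluent ⟶⟨ X ⟩
    connected⇒confluent connected {s} = confluent-at (wellFounded s)
      where
      confluent-at : ∀ {s t u} → Acc (flip _>_) s → ⟶*⟨ X ⟩ s t → ⟶*⟨ X ⟩ s u → ↓⟨ X ⟩ t u
      confluent-at _          ε        su       = _ , su , ε
      confluent-at _          st       ε        = _ , ε , st
      confluent-at (acc rs) (sa ◅ at) (sb ◅ bu) =
        let c , ac , bc = join (connected sa sb)
            d , td , cd = confluent-at (rs (step⇒> decreasing sa)) at ac
            e , de , ue = confluent-at (rs (step⇒> decreasing sb)) (bc ◅◅ cd) bu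
        in e , td ◅◅ de , ue
        where
        -- Every term of the conversion lies below the source, so the induction hypothesis closes
        -- the local peak created by each backward step.
        join : ∀ {v w} → Conversion X (_ >_) v w → ↓⟨ X ⟩ v w
        join ε                           = _ , ε , ε
        join ((fwd vv′ , _ , _) ◅ c)     = let z , v′z , wz = join c in z , vv′ ◅ v′z , wz
        join ((bwd v′v , _ , s>v′) ◅ c)  =
          let z , v′z , wz = join c
              y , vy , zy  = confluent-at (rs s>v′) (v′v ◅ ε) v′z
          in y , vy , wz ◅◅ zy

  -- Once the first rule is renamed away from the second, a single `τ` can act as `σ₂` on the
  -- variables of the second rule and as `σ₁` after the inverse renaming elsewhere.
  common-instance : Infinite 𝓥 → ∀ ℓ₁ r₁ ℓ₂ r₂ σ₁ σ₂ →
    ∃₂ λ (ρ : 𝓥 ↔ 𝓥) τ → let π = var ∘ Inverse.to ρ in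
      (∀ x → x OccursIn (ℓ₁ · π , r₁ · π) → ¬ (x OccursIn (ℓ₂ , r₂))) ×
      (ℓ₁ · π · τ ≡ ℓ₁ · σ₁ × r₁ · π · τ ≡ r₁ · σ₁) ×
      (ℓ₂ · τ ≡ ℓ₂ · σ₂ × r₂ · τ ≡ r₂ · σ₂)
  common-instance inf ℓ₁ r₁ ℓ₂ r₂ σ₁ σ₂ with rename-apart inf (vars ℓ₂ ++ vars r₂) (vars ℓ₁ ++ vars r₁)
  ... | ρ , apart = ρ , τ , disjoint , (τ₁ ℓ₁ ∈-++⁺ˡ , τ₁ r₁ (∈-++⁺ʳ (vars ℓ₁))) , (τ₂ ℓ₂ ∈-++⁺ˡ , τ₂ r₂ (∈-++⁺ʳ (vars ℓ₂)))
    where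
    open Inverse ρ using (to; from; strictlyInverseʳ)

    avoid : List 𝓥
    avoid = vars ℓ₂ ++ vars r₂

    τ : Subst
    τ x with em {x ∈ˡ avoid}
    ... | yes _ = σ₂ x
    ... | no  _ = σ₁ (from x)

    on-avoid : ∀ {x} → x ∈ˡ avoid → τ x ≡ σ₂ x
    on-avoid {x} x∈ with em {x ∈ˡ avoid}
    ... | yes _ = refl
    ... | no x∉ = ⊥-elim (x∉ x∈)

    off-avoid : ∀ {x} → to x ∉ˡ avoid → τ (to x) ≡ σ₁ x
    off-avoid {x} x∉ with em {to x ∈ˡ avoid}
    ... | yes x∈ = ⊥-elim (x∉ x∈)
    ... | no _   = cong σ₁ (strictlyInverseʳ x)

    τ₁ : ∀ t → (∀ {x} → x ∈ˡ vars t → x ∈ˡ vars ℓ₁ ++ vars r₁) → t · (var ∘ to) · τ ≡ t · σ₁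
    τ₁ t inc = trans (·-assoc t (var ∘ to) τ)
                     (·-cong t (λ x x∈ → off-avoid (apart (inc (∈Var⇒∈vars t x∈)))))

    τ₂ : ∀ t → (∀ {x} → x ∈ˡ vars t → x ∈ˡ avoid) → t · τ ≡ t · σ₂
    τ₂ t inc = ·-cong t (λ x x∈ → on-avoid (inc (∈Var⇒∈vars t x∈)))

    occurs₂ : ∀ {x} → x OccursIn (ℓ₂ , r₂) → x ∈ˡ avoid
    occurs₂ (inj₁ x∈) = ∈-++⁺ˡ (∈Var⇒∈vars ℓ₂ x∈)
    occurs₂ (inj₂ x∈) = ∈-++⁺ʳ (vars ℓ₂) (∈Var⇒∈vars r₂ x∈)

    disjoint : ∀ x → x OccursIn (ℓ₁ · (var ∘ to) , r₁ · (var ∘ to)) → ¬ (x OccursIn (ℓ₂ , r₂))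
    disjoint x (inj₁ x∈) occ with ∈Var-rename ℓ₁ to x∈
    ... | y , y∈ , refl = apart (∈-++⁺ˡ (∈Var⇒∈vars ℓ₁ y∈)) (occurs₂ occ)
    disjoint x (inj₂ x∈) occ with ∈Var-rename r₁ to x∈
    ... | y , y∈ , refl = apart (∈-++⁺ʳ (vars ℓ₁) (∈Var⇒∈vars r₁ y∈)) (occurs₂ occ)

  module CriticalPeaks (inf : Infinite 𝓥) (X : Pairs) (decreasing : Decreasing X)
    (pcp-connected : ∀ {s t} → PCP X (s , t) → ∀ δ {w} → w > (s · δ) → w > (t · δ) →
                     Conversion X (w >_) (s · δ) (t · δ)) where

    open IsTRS (decreasing⇒isTRS decreasing) using (rhs-vars)

    -- Handles the root overlaps that the definition of overlap excludes. The substitutions agree on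
    -- the variables of `ℓ₂`, hence on those of `r₂`, and the peak is trivial.
    variant-peak : ∀ {ℓ₁ r₁ ℓ₂ r₂} τ → X (ℓ₂ , r₂) → (ℓ₁ , r₁) IsVariantOf (ℓ₂ , r₂) →
      ℓ₂ · τ ≡ ℓ₁ · τ → r₁ · τ ≡ r₂ · τ
    variant-peak {ℓ₂ = ℓ₂} {r₂} τ rule (ρ , refl , refl) e =
      trans (·-assoc r₂ _ τ) (·-cong r₂ λ x x∈ →
        sym (·-agree ℓ₂ (trans e (·-assoc ℓ₂ _ τ)) x (rhs-vars rule x∈)))

    -- An inner redex inside the substitution part gives a joinable variable overlap. At a function
    -- position the peak is either trivial or an instance, by the factor `δ` of `τ` through the most
    -- general unifier, of a prime critical pair.
    root-peak : ∀ {ℓ₁ r₁ ℓ₂ r₂ σ₁ σ₂} D → X (ℓ₁ , r₁) → X (ℓ₂ , r₂) →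
      InnermostRedex X (ℓ₁ · σ₁) → ℓ₂ · σ₂ ≡ D [ ℓ₁ · σ₁ ] →
      Conversion X ((ℓ₂ · σ₂) >_) (r₂ · σ₂) (D [ r₁ · σ₁ ])
    root-peak {ℓ₁} {r₁} {ℓ₂} {r₂} {σ₁} {σ₂} D rule₁ rule₂ inn e
      with common-instance inf ℓ₁ r₁ ℓ₂ r₂ σ₁ σ₂
    ... | ρ , τ , disjoint , (ℓ₁τ , r₁τ) , (ℓ₂τ , r₂τ)
      with locate X ℓ₂ τ D (trans ℓ₂τ e)
    ... | in-variable x D′ e′ h = joinable⇒conversion decreasing s>r₂σ₂ s>Dr₁σ₁
            ( r₂ · (τ [ x ≔ _ ])
            , subst (λ u → ⟶*⟨ X ⟩ u (r₂ · (τ [ x ≔ _ ]))) r₂τ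
                (·-steps r₂ (≔-steps τ x _ (subst (λ u → ⟶*⟨ X ⟩ u _) (sym e′) (step-[] D′ redex ◅ ε))))
            , h _ redex ◅◅ (step rule₂ □ _ refl refl ◅ ε))
      where
      redex : ⟶⟨ X ⟩ (ℓ₁ · σ₁) (r₁ · σ₁)
      redex = step rule₁ □ σ₁ refl refl
      s>r₂σ₂ : (ℓ₂ · σ₂) > (r₂ · σ₂)
      s>r₂σ₂ = step⇒> decreasing (step rule₂ □ σ₂ refl refl)
      s>Dr₁σ₁ : (ℓ₂ · σ₂) > (D [ r₁ · σ₁ ])
      s>Dr₁σ₁ = step⇒> decreasing (step rule₁ D σ₁ e refl)
    ... | at-function p nonvar e′ h
      with em {p ≡ ε × (ℓ₁ · (var ∘ Inverse.to ρ) , r₁ · (var ∘ Inverse.to ρ)) IsVariantOf (ℓ₂ , r₂)}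
    ...   | yes (refl , variant) = subst (Conversion X _ (r₂ · σ₂))
              (trans (sym r₂τ) (trans (sym (variant-peak τ rule₂ variant (trans e′ (sym ℓ₁τ)))) (trans r₁τ (sym (h _)))))
              ε
    ...   | no ¬variant
      with mgu-exists {ℓ₁ · (var ∘ Inverse.to ρ)} {ℓ₂ ∣ p} τ (trans ℓ₁τ (sym e′))
    ...     | μ , mgu@(_ , general) with general τ (trans ℓ₁τ (sym e′))
    ...       | δ , τ≡μδ = conversion-sym
                  (subst₂ (Conversion X ((ℓ₂ · σ₂) >_)) left right
                    (pcp-connected pcp δ
                      (subst ((ℓ₂ · σ₂) >_) (sym left) (step⇒> decreasing (step rule₁ D σ₁ e refl)))
                      (subst ((ℓ₂ · σ₂) >_) (sym right) (step⇒> decreasing (step rule₂ □ σ₂ refl refl)))))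
      where
      π : Subst
      π = var ∘ Inverse.to ρ

      μδ≡τ : ∀ x → μ x · δ ≡ τ x
      μδ≡τ x = sym (τ≡μδ x)

      left : replace (ℓ₂ · μ) (p ⟨ μ ⟩) (r₁ · π · μ) · δ ≡ D [ r₁ · σ₁ ]
      left = trans (replace-· ℓ₂ p (r₁ · π · μ) μδ≡τ)
               (trans (cong (replace (ℓ₂ · τ) (p ⟨ τ ⟩)) (trans (·-factor (r₁ · π) μδ≡τ) r₁τ)) (sym (h _)))

      right : r₂ · μ · δ ≡ r₂ · σ₂
      right = trans (·-factor r₂ μδ≡τ) r₂τ

      redex-instance : (ℓ₂ · μ ∣ p ⟨ μ ⟩) · δ ≡ ℓ₁ · σ₁
      redex-instance = trans (cong (_· δ) (∣-· ℓ₂ p μ)) (trans (·-factor (ℓ₂ ∣ p) μδ≡τ) e′)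

      theOverlap : Overlap X
      theOverlap = record
        { variant₁  = (ℓ₁ , r₁) , rule₁ , ρ , refl , refl
        ; variant₂  = (ℓ₂ , r₂) , rule₂ , ↔-id 𝓥 , sym (·-id ℓ₂) , sym (·-id r₂)
        ; disjoint  = disjoint
        ; p         = p
        ; p-nonvar  = nonvar
        ; unifiable = τ , trans ℓ₁τ (sym e′)
        ; root      = λ p≡ε variant → ¬variant (p≡ε , variant)
        }

      pcp : PCP X (replace (ℓ₂ · μ) (p ⟨ μ ⟩) (r₁ · π · μ) , r₂ · μ)
      pcp = record
        { source = theOverlap
        ; σ      = μ
        ; mgu    = mgu
        ; pair   = refl
        -- If a proper subterm `u` of the overlapped term were reducible, `u · δ` would be a
        -- reducible proper subterm of the innermost redex.
        ; prime  = λ u sub (v , uv) →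
            inn (u · δ) (subst ((u · δ) ProperSubtermOf_) redex-instance (properSubterm-· δ sub))
                (v · δ , step-close □ δ uv)
        }

    module _ {ℓ₁ r₁ ℓ₂ r₂ : Term} {σ₁ σ₂ : Subst} (rule₁ : X (ℓ₁ , r₁)) (rule₂ : X (ℓ₂ , r₂))
      (inn : InnermostRedex X (ℓ₁ · σ₁)) where

      private
        a a′ b b′ : Term
        a  = ℓ₂ · σ₂
        a′ = r₂ · σ₂
        b  = ℓ₁ · σ₁
        b′ = r₁ · σ₁

        a→a′ : ⟶⟨ X ⟩ a a′
        a→a′ = step rule₂ □ σ₂ refl refl

        b→b′ : ⟶⟨ X ⟩ b b′
        b→b′ = step rule₁ □ σ₁ refl refl

      parallel-peak : ∀ {s t u v} → ⟶⟨ X ⟩ s t → ⟶⟨ X ⟩ s u → ⟶⟨ X ⟩ t v → ⟶⟨ X ⟩ u v → Conversion X (s >_) t u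
      parallel-peak st su tv uv = joinable⇒conversion decreasing
        (step⇒> decreasing st) (step⇒> decreasing su) (_ , tv ◅ ε , uv ◅ ε)

      mutual
        -- The common part of both contexts is peeled off. Where they diverge, the redexes are
        -- parallel and the steps commute. If the hole of `D` came first, the redex `a` would lie
        -- properly inside the innermost redex `b`.
        innermost-peak : ∀ C D → C [ a ] ≡ D [ b ] → Conversion X ((C [ a ]) >_) (C [ a′ ]) (D [ b′ ])
        innermost-peak □          D          e = root-peak D rule₁ rule₂ inn e
        innermost-peak (fun f Cs) □          e = ⊥-elim
          (inn a (subst (a ProperSubtermOf_) e (argument-properSubterm f Cs a)) (a′ , a→a′))
        innermost-peak (fun f Cs) (fun g Ds) e with fun-symbol e
        ... | refl = innermost-peakᵛ (fun-fills f) Cs Ds (fun-injective e)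

        innermost-peakᵛ : ∀ {n} {W : Vec Term n → Term} → FillsArguments W → ∀ Cs Ds → Cs [ a ]ᵛ ≡ Ds [ b ]ᵛ →
          Conversion X ((W (Cs [ a ]ᵛ)) >_) (W (Cs [ a′ ]ᵛ)) (W (Ds [ b′ ]ᵛ))
        innermost-peakᵛ fills (C ◂ us) (D ◂ vs) e with ∷-injective e
        ... | e₁ , refl with fill fills (□ ◂ us)
        ...   | E , eq rewrite eq (C [ a ]) | eq (C [ a′ ]) | eq (D [ b′ ]) =
                conversion-[] E (innermost-peak C D e₁)
        innermost-peakᵛ fills (C ◂ us) (v ▸ Ds) e with ∷-injective e
        ... | refl , refl = parallel-peak
                (step-fill fills (□ ◂ us) (step-[] C a→a′))
                (step-fill fills (v ▸ Ds) b→b′)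
                (step-fill fills ((C [ a′ ]) ▸ Ds) b→b′)
                (step-fill fills (□ ◂ (Ds [ b′ ]ᵛ)) (step-[] C a→a′))
        innermost-peakᵛ fills (u ▸ Cs) (D ◂ vs) e with ∷-injective e
        ... | refl , refl = parallel-peak
                (step-fill fills (u ▸ Cs) a→a′)
                (step-fill fills (□ ◂ vs) (step-[] D b→b′))
                (step-fill fills (□ ◂ (Cs [ a′ ]ᵛ)) (step-[] D b→b′))
                (step-fill fills ((D [ b′ ]) ▸ Cs) a→a′)
        innermost-peakᵛ fills (u ▸ Cs) (v ▸ Ds) e with ∷-injective e
        ... | refl , e₂ = innermost-peakᵛ (∷-fills u fills) Cs Ds e₂

    -- Both steps are compared with a step at an innermost redex of s: every
    -- overlap involving such a redex is prime.
    peaks-connected : PeaksConnected decreasing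
    peaks-connected {s} st@(step rule C σ refl refl) (step rule′ C′ σ′ e refl)
      with innermost-step {X} s (_ , st) (<-wellFounded _)
    ... | innermost rule″ D τ e′ inn =
      innermost-peak rule″ rule inn C D e′ ◅◅
      conversion-sym (subst (λ u → Conversion X (u >_) _ _) (sym e)
        (innermost-peak rule″ rule′ inn C′ D (trans (sym e) e′)))

-- Completion runs

-- If `P` is never lost from one index to the next, it propagates upwards from `i`. The index of a
-- loss may also precede `i`: only its existence matters, since fates are expressed in the unions
-- over all stages.
persists-or-leaves : ExcludedMiddle 0ℓ → (P : ℕ → Set) → ∀ {i} → P i →
  (∀ {j} → i ≤ j → P j) ⊎ ∃ λ j → P j × ¬ P (suc j)
persists-or-leaves em P {i} Pi with em {∃ λ j → P j × ¬ P (suc j)}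
... | yes leaves = inj₂ leaves
... | no ¬leaves = inj₁ (persists ∘ ℕ.≤⇒≤′)
  where
  persists : ∀ {j} → i ≤′ j → P j
  persists ≤′-refl = Pi
  persists (≤′-step {j} i≤j) with em {P (suc j)}
  ... | yes Pj = Pj
  ... | no ¬Pj = ⊥-elim (¬leaves (j , persists i≤j , ¬Pj))

module Runs (em : ExcludedMiddle 0ℓ) (𝓕 : Signature) (𝓥 : Set)
  (_>_ : Rel (Rewriting.Term 𝓕 𝓥) 0ℓ) (isReductionOrder : Rewriting.IsReductionOrder 𝓕 𝓥 _>_)
  (E R : ℕ → Rewriting.Pairs 𝓕 𝓥) (run : Rewriting.Completion.IsRun 𝓕 𝓥 _>_ E R) where

  open Rewriting 𝓕 𝓥
  open Completion _>_
  open Terms 𝓕 𝓥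
  open Ordered em 𝓕 𝓥 _>_ isReductionOrder
  open IsReductionOrder isReductionOrder
  open IsRun run

  decreasing : ∀ i → Decreasing (R i)
  decreasing zero    rule = ⊥-elim (start _ rule)
  decreasing (suc i) with steps i
  ... | _ , _ , (_ , _ , R′⊆R) , inference , _ , _ , R⊆R′ = preserved inference (decreasing i ∘ R′⊆R) ∘ R⊆R′
    where
    preserved : ∀ {E R E′ R′} → (E , R) ⊢ (E′ , R′) → Decreasing R → Decreasing R′
    preserved (deduce _ _)      dec rule        = dec rule
    preserved (orientˡ _ s>t)   dec (inj₁ rule) = dec rule
    preserved (orientˡ _ s>t)   dec (inj₂ refl) = s>t
    preserved (orientʳ _ t>s)   dec (inj₁ rule) = dec rule
    preserved (orientʳ _ t>s)   dec (inj₂ refl) = t>s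
    preserved (delete _)        dec rule        = dec rule
    preserved (compose _ t→u)   dec (inj₁ rule) = dec (inj₁ rule)
    preserved (compose _ t→u)   dec (inj₂ refl) = >-trans (dec (inj₂ refl)) (step⇒> (dec ∘ inj₁) t→u)
    preserved (simplifyˡ _ _)   dec rule        = dec rule
    preserved (simplifyʳ _ _)   dec rule        = dec rule
    preserved (collapse _ _ _ _) dec rule       = dec (inj₁ rule)

  decreasing-∞ : Decreasing (R ∞)
  decreasing-∞ (i , rule) = decreasing i rule

  ω⊆∞ : ∀ {X : ℕ → Pairs} {e} → (X ω) e → (X ∞) e
  ω⊆∞ (i , persistent) = i , persistent (i , ℕ.≤-refl)

  decreasing-ω : Decreasing (R ω)
  decreasing-ω rule = decreasing-∞ (ω⊆∞ {R} rule)

  Sound : Pairs → Set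
  Sound X = ∀ {s t} → X (s , t) → ⟷*⟨ E zero ⟩ s t

  sound-steps : ∀ {X} → Sound X → ∀ {s t} → ⟶⟨ X ⟩ s t → ⟷*⟨ E zero ⟩ s t
  sound-steps sound (step rule C σ refl refl) = Eq.gmap (λ t → C [ t · σ ]) (step-close C σ) (sound rule)

  sound : ∀ i → Sound (E i) × Sound (R i)
  sound zero    = (λ equation → fwd (step-rule equation) ◅ ε) , (λ rule → ⊥-elim (start _ rule))
  sound (suc i) with steps i
  ... | _ , _ , ((_ , E′⊆E) , (_ , R′⊆R)) , inference , (_ , E⊆E′) , (_ , R⊆R′) =
      let soundᴱ , soundᴿ = preserved inference (proj₁ (sound i) ∘ E′⊆E) (proj₂ (sound i) ∘ R′⊆R)
      in soundᴱ ∘ E⊆E′ , soundᴿ ∘ R⊆R′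
    where
    flip-sound : ∀ {s t} → ⟷*⟨ E zero ⟩ s t → ⟷*⟨ E zero ⟩ t s
    flip-sound = Eq.symmetric _

    add : ∀ {X : Pairs} {s t} → Sound X → ⟷*⟨ E zero ⟩ s t → Sound (λ e → X e ⊎ (s , t) ≡ e)
    add soundˣ st (inj₁ e)    = soundˣ e
    add soundˣ st (inj₂ refl) = st

    preserved : ∀ {E R E′ R′} → (E , R) ⊢ (E′ , R′) → Sound E → Sound R → Sound E′ × Sound R′
    preserved (deduce w→s w→t) e r =
      add e (flip-sound (sound-steps r w→s) ◅◅ sound-steps r w→t) , r
    preserved (orientˡ _ _) e r = e ∘ inj₁ , add r (e (inj₂ refl))
    preserved (orientʳ _ _) e r = e ∘ inj₁ , add r (flip-sound (e (inj₂ refl)))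
    preserved (delete _) e r = e ∘ inj₁ , r
    preserved (compose _ t→u) e r =
      e , add (r ∘ inj₁) (r (inj₂ refl) ◅◅ sound-steps (r ∘ inj₁) t→u)
    preserved (simplifyˡ _ s→u) e r =
      add (e ∘ inj₁) (flip-sound (sound-steps r s→u) ◅◅ e (inj₂ refl)) , r
    preserved (simplifyʳ _ t→u) e r =
      add (e ∘ inj₁) (e (inj₂ refl) ◅◅ sound-steps r t→u) , r
    preserved (collapse _ rule t→u _) e r =
      add e (flip-sound (sound-steps (λ { refl → r (inj₁ rule) }) t→u) ◅◅ r (inj₂ refl)) , r ∘ inj₁

  -- What becomes of rules and equations that leave

  data RuleFate (ℓ r : Term) : Set where
    composed  : ∀ {u} → ⟶⟨ R ∞ ⟩ r u → (R ∞) (ℓ , u) → RuleFate ℓ r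
    collapsed : ∀ {u ℓ′ r′} → (R ∞) (ℓ′ , r′) → ⟶⟨ ｛ ℓ′ , r′ ｝ ⟩ ℓ u → ℓ ▷ ℓ′ → (E ∞) (u , r) → RuleFate ℓ r

  removed-rule-fate : ∀ {ℓ r} i → R i (ℓ , r) → ¬ R (suc i) (ℓ , r) → RuleFate ℓ r
  removed-rule-fate i rule gone with steps i
  ... | _ , _ , (_ , (R⊆S , S⊆R)) , inference , (F⊆E , _) , (S⊆R′ , _) = cases inference (R⊆S rule)
      (λ r → i , S⊆R r) (λ e → suc i , F⊆E e) (λ r → suc i , S⊆R′ r) (gone ∘ S⊆R′)
    where
    cases : ∀ {F S F′ S′ ℓ r} → (F , S) ⊢ (F′ , S′) → S (ℓ , r) →
      (∀ {e} → S e → (R ∞) e) → (∀ {e} → F′ e → (E ∞) e) → (∀ {e} → S′ e → (R ∞) e) →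
      ¬ S′ (ℓ , r) → RuleFate ℓ r
    cases (deduce _ _)      rule _ _ _ gone = ⊥-elim (gone rule)
    cases (orientˡ _ _)     rule _ _ _ gone = ⊥-elim (gone (inj₁ rule))
    cases (orientʳ _ _)     rule _ _ _ gone = ⊥-elim (gone (inj₁ rule))
    cases (delete _)        rule _ _ _ gone = ⊥-elim (gone rule)
    cases (simplifyˡ _ _)   rule _ _ _ gone = ⊥-elim (gone rule)
    cases (simplifyʳ _ _)   rule _ _ _ gone = ⊥-elim (gone rule)
    cases (compose _ _)     (inj₁ rule) _ _ _ gone = ⊥-elim (gone (inj₁ rule))
    cases (compose _ t→u)   (inj₂ refl) old _ new _ = composed (step-map (old ∘ inj₁) t→u) (new (inj₂ refl))
    cases (collapse _ _ _ _) (inj₁ rule) _ _ _ gone = ⊥-elim (gone rule)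
    cases (collapse _ rule t→u t▷ℓ) (inj₂ refl) old newᴱ _ _ =
      collapsed (old (inj₁ rule)) t→u t▷ℓ (newᴱ (inj₂ refl))

  rule-fate : ∀ {ℓ r} → (R ∞) (ℓ , r) → (R ω) (ℓ , r) ⊎ RuleFate ℓ r
  rule-fate {ℓ} {r} (i , rule) with persists-or-leaves em (λ j → R j (ℓ , r)) rule
  ... | inj₁ persistent           = inj₁ (i , λ (j , i≤j) → persistent i≤j)
  ... | inj₂ (j , present , gone) = inj₂ (removed-rule-fate j present gone)

  data EquationFate (s t : Term) : Set where
    orientedˡ   : (R ∞) (s , t) → EquationFate s t
    orientedʳ   : (R ∞) (t , s) → EquationFate s t
    deleted     : s ≡ t → EquationFate s t
    simplifiedˡ : ∀ {u} → ⟶⟨ R ∞ ⟩ s u → (E ∞) (u , t) → EquationFate s t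
    simplifiedʳ : ∀ {u} → ⟶⟨ R ∞ ⟩ t u → (E ∞) (s , u) → EquationFate s t

  removed-equation-fate : ∀ {s t} i → E i (s , t) → ¬ E (suc i) (s , t) → EquationFate s t
  removed-equation-fate i equation gone with steps i
  ... | _ , _ , ((E⊆F , _) , (_ , S⊆R)) , inference , (F⊆E , _) , (S⊆R′ , _) = cases inference (E⊆F equation)
      (λ r → i , S⊆R r) (λ e → suc i , F⊆E e) (λ r → suc i , S⊆R′ r) (gone ∘ F⊆E)
    where
    cases : ∀ {F S F′ S′ s t} → (F , S) ⊢ (F′ , S′) → F (s , t) →
      (∀ {e} → S e → (R ∞) e) → (∀ {e} → F′ e → (E ∞) e) → (∀ {e} → S′ e → (R ∞) e) →
      ¬ F′ (s , t) → EquationFate s t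
    cases (deduce _ _)       e _ _ _ gone = ⊥-elim (gone (inj₁ e))
    cases (compose _ _)      e _ _ _ gone = ⊥-elim (gone e)
    cases (collapse _ _ _ _) e _ _ _ gone = ⊥-elim (gone (inj₁ e))
    cases (orientˡ _ _)      (inj₁ e)    _ _ _ gone = ⊥-elim (gone e)
    cases (orientˡ _ _)      (inj₂ refl) _ _ new _ = orientedˡ (new (inj₂ refl))
    cases (orientʳ _ _)      (inj₁ e)    _ _ _ gone = ⊥-elim (gone e)
    cases (orientʳ _ _)      (inj₂ refl) _ _ new _ = orientedʳ (new (inj₂ refl))
    cases (delete _)         (inj₁ e)    _ _ _ gone = ⊥-elim (gone e)
    cases (delete _)         (inj₂ refl) _ _ _ _ = deleted refl
    cases (simplifyˡ _ _)    (inj₁ e)    _ _ _ gone = ⊥-elim (gone (inj₁ e))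
    cases (simplifyˡ _ s→u)  (inj₂ refl) old new _ _ = simplifiedˡ (step-map old s→u) (new (inj₂ refl))
    cases (simplifyʳ _ _)    (inj₁ e)    _ _ _ gone = ⊥-elim (gone (inj₁ e))
    cases (simplifyʳ _ t→u)  (inj₂ refl) old new _ _ = simplifiedʳ (step-map old t→u) (new (inj₂ refl))

  step-focus : ∀ {X s t} → ⟶⟨ X ⟩ s t → ∃₂ λ ℓ r → X (ℓ , r) × ⟶⟨ ｛ ℓ , r ｝ ⟩ s t × s ⊵ ℓ
  step-focus (step rule C σ e e′) = _ , _ , rule , step refl C σ e e′ , (C , σ , e)

  -- Rewriting one side of a pair is carried over to every instance of the pair in context: the step
  -- from `C [ ℓ · σ ]` to `C [ r · σ ]` makes a detour through `C [ u · σ ]`.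
  step-through : ∀ {Y ℓ r u v w} → ⟶⟨ ｛ ℓ , r ｝ ⟩ v w → ⟶⟨ Y ⟩ ℓ u →
    ∃ λ x → ⟶⟨ Y ⟩ v x × ⟶⟨ ｛ u , r ｝ ⟩ x w
  step-through {u = u} (step refl C σ refl refl) ℓu =
    C [ u · σ ] , step-close C σ ℓu , step refl C σ refl refl

  rule-step⇒> : ∀ {ℓ r s t} → (R ∞) (ℓ , r) → ⟶⟨ ｛ ℓ , r ｝ ⟩ s t → s > t
  rule-step⇒> rule = step⇒> λ { refl → decreasing-∞ rule }

  step-flip : ∀ {s t v w} → ⟶⟨ ｛ s , t ｝ ⟩ v w → ⟶⟨ ｛ t , s ｝ ⟩ w v
  step-flip (step refl C σ e e′) = step refl C σ e′ e

  -- `B` is a downward closed bound on the terms of conversions. It becomes `w >_` for critical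
  -- pairs, and holds everywhere when only the equational theory matters.
  module Bounded (no-persistent-equations : ∀ e → ¬ (E ω) e)
    (B : Term → Set) (B-closed : ∀ {s t} → B s → s > t → B t) where

    -- For rules the bound on the source suffices, since the target is smaller; an equation has no
    -- such direction and needs both ends bounded.
    RuleBounded : Term → Term → Set
    RuleBounded ℓ r = ∀ {v w} → ⟶⟨ ｛ ℓ , r ｝ ⟩ v w → B v → Conversion (R ω) B v w

    EquationBounded : Term → Term → Set
    EquationBounded s t = ∀ {v w} → ⟶⟨ ｛ s , t ｝ ⟩ v w → B v → B w → Conversion (R ω) B v w

    equation-fate : ∀ {s t} → (E ∞) (s , t) → EquationFate s t
    equation-fate {s} {t} (i , equation) with persists-or-leaves em (λ j → E j (s , t)) equation
    ... | inj₁ persistent           = ⊥-elim (no-persistent-equations (s , t) (i , λ (j , i≤j) → persistent i≤j))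
    ... | inj₂ (j , present , gone) = removed-equation-fate j present gone

    -- K delimits the terms below which all rules are already known to be bounded.
    equation-bounded : (K : Term → Set) → (∀ {s t} → K s → s > t → K t) →
      (∀ {s ℓ r} → K s → s ⊵ ℓ → (R ∞) (ℓ , r) → RuleBounded ℓ r) →
      ∀ {s t} → K s → Acc (flip _>_) s → K t → Acc (flip _>_) t → EquationFate s t → EquationBounded s t
    equation-bounded K K-closed K-rules Ks _ Kt _ (orientedˡ rule) vw Bv Bw = K-rules Ks ⊵-refl rule vw Bv
    equation-bounded K K-closed K-rules Ks _ Kt _ (orientedʳ rule) vw Bv Bw =
      conversion-sym (K-rules Kt ⊵-refl rule (step-flip vw) Bw)
    equation-bounded K K-closed K-rules Ks _ Kt _ (deleted refl) (step refl C σ refl refl) Bv Bw = ε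
    -- The rule that rewrites `s` has its left-hand side encompassed by `s`, so `K-rules` covers it;
    -- the remaining equation has a smaller left side.
    equation-bounded K K-closed K-rules Ks (acc rs) Kt at (simplifiedˡ s→u equation) vw Bv Bw =
      let ℓ , r , rule , s→u′ , s⊵ℓ = step-focus s→u
          x , vx , xw = step-through vw s→u′
          s>u = step⇒> decreasing-∞ s→u
      in K-rules Ks s⊵ℓ rule vx Bv ◅◅
         equation-bounded K K-closed K-rules (K-closed Ks s>u) (rs s>u) Kt at
           (equation-fate equation) xw (B-closed Bv (rule-step⇒> rule vx)) Bw
    equation-bounded K K-closed K-rules Ks as Kt (acc rt) (simplifiedʳ t→u equation) vw Bv Bw =
      let ℓ , r , rule , t→u′ , t⊵ℓ = step-focus t→u
          x , wx , xv = step-through (step-flip vw) t→u′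
          t>u = step⇒> decreasing-∞ t→u
      in equation-bounded K K-closed K-rules Ks as (K-closed Kt t>u) (rt t>u)
           (equation-fate equation) (step-flip xv) Bv (B-closed Bw (rule-step⇒> rule wx)) ◅◅
         conversion-sym (K-rules Kt t⊵ℓ rule wx Bw)

    -- Composition keeps `ℓ` and lowers `r`; the rule used for it has a left-hand side encompassed
    -- by `r`, hence below `ℓ` in `≻` because `ℓ > r`. The rule used for a collapse has a left-hand
    -- side properly encompassed by `ℓ`.
    rule-bounded : ∀ {ℓ r} → Acc (flip _≻_) ℓ → Acc (flip _>_) r → (R ∞) (ℓ , r) →
      (R ω) (ℓ , r) ⊎ RuleFate ℓ r → RuleBounded ℓ r
    rule-bounded _ _ rule (inj₁ persistent) vw Bv =
      (fwd (step-map (λ { refl → persistent }) vw) , Bv , B-closed Bv (rule-step⇒> rule vw)) ◅ ε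
    rule-bounded {ℓ} {r} aℓ@(acc rℓ) (acc rr) rule (inj₂ (composed r→u rule′)) vw Bv =
      let ℓ″ , r″ , rule″ , r→u′ , r⊵ℓ″ = step-focus r→u
          x , wx , xv = step-through (step-flip vw) r→u′
      in rule-bounded aℓ (rr (step⇒> decreasing-∞ r→u)) rule′ (rule-fate rule′) (step-flip xv) Bv ◅◅
         conversion-sym (rule-bounded (rℓ (inj₁ (r , decreasing-∞ rule , r⊵ℓ″))) (wellFounded r″) rule″
           (rule-fate rule″) wx (B-closed Bv (rule-step⇒> rule vw)))
    rule-bounded {ℓ} {r} (acc rℓ) _ rule (inj₂ (collapsed {u} {r′ = r′} rule′ ℓ→u ℓ▷ℓ′ equation)) vw Bv =
      let x , vx , xw = step-through vw ℓ→u
      in rule-bounded (rℓ (inj₂ ℓ▷ℓ′)) (wellFounded r′) rule′ (rule-fate rule′) vx Bv ◅◅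
         -- Both sides of the equation created by the collapse lie below `ℓ`, and any rule whose
         -- left-hand side is encompassed by a term below `ℓ` falls under the induction hypothesis.
         equation-bounded (ℓ >_) >-trans
           (λ ℓ>s s⊵ℓ″ rule″ → rule-bounded (rℓ (inj₁ (_ , ℓ>s , s⊵ℓ″))) (wellFounded _) rule″ (rule-fate rule″))
           (rule-step⇒> rule′ ℓ→u) (wellFounded u) (decreasing-∞ rule) (wellFounded r)
           (equation-fate equation) xw
           (B-closed Bv (rule-step⇒> rule′ vx)) (B-closed Bv (rule-step⇒> rule vw))

    equations-bounded : ∀ {v w} → ⟶⟨ E ∞ ⟩ v w → B v → B w → Conversion (R ω) B v w
    equations-bounded vw with step-focus vw
    -- All rules of `R ∞` are now known to be bounded, so `K` can be the set of all terms.
    ... | s , t , equation , vw′ , _ = equation-bounded (λ _ → ⊤) _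
      (λ _ _ rule → rule-bounded (≻-wellFounded _) (wellFounded _) rule (rule-fate rule))
      tt (wellFounded s) tt (wellFounded t) (equation-fate equation) vw′

  module Fair (inf : Infinite 𝓥) (fair : IsFair E R) where

    open IsFair fair

    -- Both alternatives offered by fairness are stable under `δ`: joining sequences descend from
    -- terms below `w`, and a step of `E ∞` becomes a conversion bounded by `w`.
    pcp-connected : ∀ {s t} → PCP (R ω) (s , t) → ∀ δ {w} → w > (s · δ) → w > (t · δ) →
      Conversion (R ω) (w >_) (s · δ) (t · δ)
    pcp-connected pcp δ {w} w>s w>t with prime-critical-pairs pcp
    ... | inj₁ (u , su , tu) = joinable⇒conversion decreasing-ω w>s w>t
          (u · δ , Star.gmap (_· δ) (step-close □ δ) su , Star.gmap (_· δ) (step-close □ δ) tu)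
    ... | inj₂ (fwd st) = equations-bounded (step-close □ δ st) w>s w>t
      where open Bounded no-persistent-equations (w >_) >-trans
    ... | inj₂ (bwd ts) = conversion-sym (equations-bounded (step-close □ δ ts) w>t w>s)
      where open Bounded no-persistent-equations (w >_) >-trans

    open CriticalPeaks inf (R ω) decreasing-ω pcp-connected using (peaks-connected)
    -- Without a bound, the same result turns every step of the initial equations into a conversion
    -- in `R ω`.
    open Bounded no-persistent-equations (λ _ → ⊤) _ using (equations-bounded)

    isCompletePresentation : IsCompletePresentation (R ω) (E zero)
    isCompletePresentation = record
      { isTRS      = decreasing⇒isTRS decreasing-ω
      ; isComplete = record
        { terminating = decreasing⇒terminating decreasing-ω
        ; confluent   = connected⇒confluent decreasing-ω peaks-connected
        }
      ; conversion =
          Eq.fold (Eq.isEquivalence _) (sound-steps (λ rule → let i , rule′ = ω⊆∞ {R} rule in proj₂ (sound i) rule′))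
        , Eq.fold (Eq.isEquivalence _) (λ st → Star.map proj₁ (equations-bounded (step-map (zero ,_) st) tt tt))
      }

theorem6p12 : ExcludedMiddle 0ℓ →
    (𝓕 : Signature) (𝓥 : Set) → Infinite 𝓥 →
    let open Rewriting 𝓕 𝓥 in
    (_>_ : Rel Term 0ℓ) → IsReductionOrder _>_ →
    let open Completion _>_ in
    (E R : ℕ → Pairs) → IsRun E R →
    IsFair E R → IsCompletePresentation (R ω) (E zero)
theorem6p12 em 𝓕 𝓥 inf _>_ isReductionOrder E R run fair = isCompletePresentation
  where open Runs.Fair em 𝓕 𝓥 _>_ isReductionOrder E R run inf fair
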